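{- Let $\Theta=4^{1/5}$ and let $\Gamma$ be the unique real number in $[1,2]$ satisfying $\Gamma^{ -4}+\Gamma^{ -5}+\Gamma^{ -6}=1$ (so $\Gamma\approx 1.25$). For any graph $G$ with $n$ vertices we have $\mathrm{b}(\mathrm{Ind}(G))\leq \Theta^n$. If moreover $G$ is triangle-free, then $\mathrm{b}(\mathrm{Ind}(G))\leq \Gamma^n$.
   Context: Graphs are finite, simple, undirected. Fix a field $\mathbf{k}$. The independence complex $\mathrm{Ind}(G)$ of a graph $G$ is the simplicial complex on vertex set $V(G)$ whose faces are the independent sets of $G$ (including the empty set). For a space $X$, $\mathrm{b}(X)=\sum_i \dim_{\mathbf{k}}\widetilde{H}_i(X;\mathbf{k})$ is the total (reduced) Betti number; by convention the empty complex $\emptyset$ has $\widetilde{H}_{ -1}(\emptyset)=\mathbf{k}$ and no other reduced homology, so $\mathrm{b}(\emptyset)=1$ (this is $\mathrm{Ind}$ of the graph with no vertices). -}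

module Defs where

open import Level using (Level; _⊔_) renaming (suc to lsuc)
open import Algebra.Bundles using (CommutativeRing)
open import Data.Bool using (Bool; true; false; _∧_; not; if_then_else_)
open import Data.Nat using (ℕ; zero; suc; _<_; _≡ᵇ_) renaming (_+_ to _+ℕ_)
open import Data.Fin using (Fin; zero; suc; toℕ)
open import Data.Vec using (Vec; []; _∷_; lookup)
open import Data.List using (List; []; _∷_; _++_; map; filter; length; allFin)
import Data.List as L
open import Data.Maybe using (Maybe; just; nothing)
open import Data.Product using (Σ; ∃; _×_; _,_)
open import Relation.Nullary using (¬_)
open import Relation.Binary.PropositionalEquality using (_≡_)
open import Relation.Nullary.Decidable using (does)
open import Data.Bool.Properties using (T?)
open import Data.Bool using (T)

record Field (c ℓ : Level) : Set (lsuc (c ⊔ ℓ)) where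
  field
    commutativeRing : CommutativeRing c ℓ
  open CommutativeRing commutativeRing public
  field
    0≉1     : ¬ (0# ≈ 1#)
    inverse : ∀ x → ¬ (x ≈ 0#) → Σ Carrier (λ y → x * y ≈ 1#)

record Graph (n : ℕ) : Set where
  field
    adj    : Fin n → Fin n → Bool
    sym    : ∀ i j → adj i j ≡ adj j i
    irrefl : ∀ i → adj i i ≡ false

TriangleFree : ∀ {n} → Graph n → Set
TriangleFree G = ∀ i j k →
  ¬ (T (adj i j) × T (adj j k) × T (adj i k))
  where open Graph G

Subset : ℕ → Set
Subset n = Vec Bool n

allSubsets : (n : ℕ) → List (Subset n)
allSubsets zero    = [] ∷ []
allSubsets (suc n) = map (true ∷_) (allSubsets n) ++ map (false ∷_) (allSubsets n)

card : ∀ {n} → Subset n → ℕ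
card []           = 0
card (true  ∷ σ)  = suc (card σ)
card (false ∷ σ)  = card σ

allB : ∀ {A : Set} → (A → Bool) → List A → Bool
allB p []       = true
allB p (x ∷ xs) = p x ∧ allB p xs

independent : ∀ {n} → Graph n → Subset n → Bool
independent {n} G σ =
  allB (λ i → allB (λ j → not (lookup σ i ∧ lookup σ j ∧ Graph.adj G i j)) (allFin n)) (allFin n)

-- The faces of Ind(G) with exactly k vertices (i.e. of dimension k-1),
-- in a fixed order.  k = 0 gives the empty face.
faces : ∀ {n} → Graph n → ℕ → List (Subset n)
faces {n} G k = filter (λ σ → T? (independent G σ ∧ (card σ ≡ᵇ k))) (allSubsets n)

eqVec : ∀ {m} → Subset m → Subset m → Bool
eqVec []         []         = true
eqVec (true ∷ a) (true ∷ b) = eqVec a b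
eqVec (false ∷ a) (false ∷ b) = eqVec a b
eqVec (true ∷ a) (false ∷ b) = false
eqVec (false ∷ a) (true ∷ b) = false

-- removed τ σ = just p  iff  τ = σ ∖ {v} for a vertex v ∈ σ, where p is
-- the number of vertices of σ smaller than v; otherwise nothing.
removed : ∀ {m} → Subset m → Subset m → Maybe ℕ
removed []          []          = nothing
removed (true ∷ τ)  (true ∷ σ)  with removed τ σ
... | just p  = just (suc p)
... | nothing = nothing
removed (false ∷ τ) (false ∷ σ) = removed τ σ
removed (false ∷ τ) (true ∷ σ)  = if eqVec τ σ then just 0 else nothing
removed (true ∷ τ)  (false ∷ σ) = nothing

module Homology {c ℓ : Level} (K : Field c ℓ) {n : ℕ} (G : Graph n) where
  open Field K using (Carrier; _≈_; _+_; _*_; -_; 0#; 1#)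

  sumF : ∀ {m} → (Fin m → Carrier) → Carrier
  sumF {zero}  f = 0#
  sumF {suc m} f = f zero + sumF (λ j → f (suc j))

  sign : ℕ → Carrier
  sign zero    = 1#
  sign (suc p) = - sign p

  incidence : Subset n → Subset n → Carrier
  incidence τ σ with removed τ σ
  ... | just p  = sign p
  ... | nothing = 0#

  f : ℕ → ℕ
  f k = length (faces G k)

  face : (k : ℕ) → Fin (f k) → Subset n
  face k = L.lookup (faces G k)

  Vect : ℕ → Set c
  Vect d = Fin d → Carrier

  Chain : ℕ → Set c
  Chain k = Vect (f k)

  -- boundary map from chains on faces with k+1 vertices to chains on
  -- faces with k vertices (k = 0 is the augmentation map)
  ∂ : (k : ℕ) → Chain (suc k) → Chain k
  ∂ k x t = sumF (λ s → x s * incidence (face k t) (face (suc k) s))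

  LinIndep : ∀ {r d} → (Fin r → Vect d) → Set (c ⊔ ℓ)
  LinIndep {r} {d} v =
    (a : Fin r → Carrier) →
    (∀ t → sumF (λ j → a j * v j t) ≈ 0#) → ∀ j → a j ≈ 0#

  IsDim : ∀ {d} → (Vect d → Set (c ⊔ ℓ)) → ℕ → Set (c ⊔ ℓ)
  IsDim {d} P r =
    (Σ (Fin r → Vect d) λ v → LinIndep v × (∀ j → P (v j))) ×
    (∀ m → r < m → (v : Fin m → Vect d) → LinIndep v → (∀ j → P (v j)) → Data.Empty.⊥)
    where import Data.Empty

  -- cycles Z and boundaries B in C_k (the complex ends with ∂ = 0 into degree below k = 0)
  Cycle : (k : ℕ) → Chain k → Set (c ⊔ ℓ)
  Cycle zero    x = Level.Lift _ Data.Unit.⊤ where import Data.Unit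
  Cycle (suc k) x = Level.Lift c (∀ t → ∂ k x t ≈ 0#)

  Boundary : (k : ℕ) → Chain k → Set (c ⊔ ℓ)
  Boundary k x = Σ (Chain (suc k)) λ w → ∀ t → ∂ k w t ≈ x t

  -- HomDim k h : dim_K H̃_{k-1}(Ind G ; K) = h, computed as dim Z − dim B
  HomDim : ℕ → ℕ → Set (c ⊔ ℓ)
  HomDim k h = Σ ℕ λ z → Σ ℕ λ bd →
    IsDim (Cycle k) z × IsDim (Boundary k) bd × (h +ℕ bd ≡ z)

  sumℕ : ∀ {m} → (Fin m → ℕ) → ℕ
  sumℕ {zero}  g = 0
  sumℕ {suc m} g = g zero +ℕ sumℕ (λ j → g (suc j))

  -- TotalBetti b : b(Ind G) = b  (reduced homology in degrees -1 .. n-1)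
  TotalBetti : ℕ → Set (c ⊔ ℓ)
  TotalBetti b = Σ (Fin (suc n) → ℕ) λ h →
    (∀ k → HomDim (toℕ k) (h k)) × (b ≡ sumℕ h)

TotalBettiInd : ∀ {c ℓ} → Field c ℓ → ∀ {n} → Graph n → ℕ → Set (c ⊔ ℓ)
TotalBettiInd K G b = Homology.TotalBetti K G b

{-# OPTIONS --safe #-}
-- For a vertex v, the long exact sequence of Ind(G − v) ⊆ Ind(G) gives
-- b(G) ≤ b(G − v) + b(G − N[v]), and b(G) = 0 if G has an isolated vertex.
-- Let v have minimal degree d, with neighbours u₁, …, u_d.  Deleting them one
-- after another isolates v, so b(G) ≤ Σᵢ b(G − u₁ − … − uᵢ₋₁ − N[uᵢ]).
-- Every summand has at most n − d − 1 vertices, and d ≤ Θ^(d+1).  If G is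
-- triangle-free the uᵢ are pairwise nonadjacent, hence the i-th summand has
-- at most n − d − i vertices, and Γ^(−d−1) + … + Γ^(−2d) ≤ 1, with equality
-- exactly for d = 3.
module Submission where

open import Defs
open import Level using (Level; _⊔_; Lift; lift; lower) renaming (suc to lsuc)
import Algebra.Properties.Ring as RingProperties
import Algebra.Properties.CommutativeSemigroup as CommutativeSemigroupProperties
open import Data.Bool using (Bool; true; false; not; _∧_; T; if_then_else_)
import Data.Bool as Bool
open import Data.Bool.Properties using (T?; T-∧; T-≡; T-not-≡; ∧-conicalˡ; ∧-conicalʳ; ¬-not)
open import Data.Empty using (⊥-elim)
open import Data.Fin using (Fin; zero; suc; toℕ; punchIn; _≟_)
open import Data.Fin.Properties using (any?)
open import Data.List using (List; []; _∷_; _++_; map; filter; allFin)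
import Data.List as List
open import Data.List.Membership.Propositional using (_∈_)
open import Data.List.Membership.Propositional.Properties using (∈-filter⁺; ∈-filter⁻; ∈-lookup; ∈-map⁺; ∈-map⁻; ∈-++⁺ˡ; ∈-++⁺ʳ; ∈-allFin)
open import Data.List.Relation.Unary.All as All using (All; []; _∷_)
open import Data.List.Relation.Unary.AllPairs using ([]; _∷_)
open import Data.List.Relation.Unary.Any using (here; there; index)
open import Data.List.Relation.Unary.Any.Properties using (lookup-index)
open import Data.List.Relation.Unary.Unique.Propositional using (Unique)
open import Data.List.Relation.Unary.Unique.Propositional.Properties using (map⁺; ++⁺; filter⁺)
open import Data.Maybe using (just; nothing; maybe′)
open import Data.Nat using (ℕ; zero; suc; _+_; _*_; _^_; _≤_; _<_; _≡ᵇ_; _≤?_; _<?_; s≤s; s≤s⁻¹; z≤n; NonZero; >-nonZero) renaming (_⊔_ to _⊔ℕ_)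
open import Data.Nat.Properties using (≤-refl; ≤-reflexive; ≤-trans; ≤-antisym; <⇒≤; ≰⇒>; ≮⇒≥; <⇒≱; <-≤-trans; ≤-<-trans; m≤n⇒m≤1+n; suc-injective; +-comm; +-assoc; +-suc; +-mono-≤; +-monoˡ-≤; +-monoʳ-≤; +-monoˡ-<; +-cancelʳ-≤; +-cancelˡ-<; *-zeroʳ; *-mono-≤; *-monoˡ-≤; *-monoʳ-≤; *-cancelˡ-<; *-cancelʳ-≤; ^-monoˡ-≤; ^-monoʳ-≤; ^-distribˡ-+-*; m^n≢0; m*n≢0; m≤m+n; m≤m⊔n; m≤n⊔m; ⊔-sel; m≤n⇒∃[o]m+o≡n; ≡ᵇ⇒≡; ≡⇒≡ᵇ; module ≤-Reasoning)
open import Data.Nat.Solver using (module +-*-Solver)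
open import Data.Nat.Tactic.RingSolver using (solve-∀)
open import Data.Product using (∃; Σ; _×_; _,_; proj₁; proj₂)
open import Data.Sum using (inj₁; inj₂)
open import Data.Vec using ([]; _∷_; lookup; _[_]≔_; replicate)
open import Data.Vec.Functional using (insertAt)
open import Data.Vec.Functional.Properties using (insertAt-lookup; insertAt-punchIn)
open import Data.Vec.Properties using (lookup∘update; lookup∘update′; ≡-dec; ∷-injectiveʳ)
open import Function using (_∘_; Equivalence)
open import Relation.Binary.PropositionalEquality using (_≡_; _≢_; refl; trans; sym; cong; subst)
import Relation.Binary.Reasoning.Setoid as SetoidReasoning
open import Relation.Nullary using (¬_; Dec; yes; no; does; contradiction; ¬¬-excluded-middle)
open import Relation.Nullary.Decidable using (decidable-stable; _×-dec_)
open +-*-Solver using (solve; _:=_; _:+_; _:*_; _:^_; con)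

-- Equality in the field is not assumed decidable, so ranks cannot be computed and bases of homology
-- cannot be constructed. Upper bounds on dim Z/B are therefore carried by flags of linear
-- relations, which pass through exact sequences without choices. Only at the end is a flag played
-- against the independent families that define `IsDim`. The conclusion there is an inequality of
-- natural numbers, hence decidable, so classical case distinctions are allowed. All induced
-- subgraphs share one chain space, the functions on all subsets of the vertices. Vertex set and
-- degree enter only as a support condition, so nothing is ever reindexed. Θ and Γ never occur as
-- real numbers: b ≤ Θⁿ becomes b⁵ ≤ 4ⁿ, and b ≤ Γⁿ becomes b ≤ (p/q)ⁿ for every rational p/q whose
-- powers -4, -5, -6 sum to less than 1, that is, for every p/q > Γ.

-- Flags bounding the dimension of a quotient, and linear operators

module VectorSpace {c ℓ : Level} (K : Field c ℓ) where
  open Field K using (Carrier; _≈_; 0#; 1#; -_) renaming (_+_ to _⊕_; _*_ to _⊛_)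
  module F = Field K
  module FP = RingProperties F.ring
  open SetoidReasoning F.setoid
  open CommutativeSemigroupProperties F.+-commutativeSemigroup public
    using (interchange; x∙yz≈y∙xz)

  Pred : Set → Set (lsuc (c ⊔ ℓ))
  Pred X = (X → Carrier) → Set (c ⊔ ℓ)

  infix 4 _≋_
  _≋_ : {X : Set} → (X → Carrier) → (X → Carrier) → Set ℓ
  x ≋ y = ∀ t → x t ≈ y t

  infixl 6 _+[_]_
  _+[_]_ : {X : Set} → (X → Carrier) → Carrier → (X → Carrier) → X → Carrier
  (x +[ a ] y) t = x t ⊕ a ⊛ y t

  comb-cong : ∀ {x x′ y y′} a → x ≈ x′ → y ≈ y′ → x ⊕ a ⊛ y ≈ x′ ⊕ a ⊛ y′
  comb-cong a p q = F.+-cong p (F.*-congˡ q)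

  comb-interchange : ∀ x y z w a →
    (x ⊕ a ⊛ y) ⊕ (z ⊕ a ⊛ w) ≈ (x ⊕ z) ⊕ a ⊛ (y ⊕ w)
  comb-interchange x y z w a = F.trans (interchange _ _ _ _)
    (F.+-congˡ (F.sym (F.distribˡ a y w)))

  neg-comb : ∀ x y a → - (x ⊕ a ⊛ y) ≈ - x ⊕ a ⊛ (- y)
  neg-comb x y a = F.trans (F.sym (FP.-‿+-comm _ _))
    (F.+-congˡ (FP.-‿distribʳ-* a y))

  comb-zero : ∀ {x y} a → x ≈ 0# → y ≈ 0# → x ⊕ a ⊛ y ≈ 0#
  comb-zero a p q = F.trans (comb-cong a p q)
    (F.trans (F.+-identityˡ _) (F.zeroʳ a))

  -0≈0 : - 0# ≈ 0#
  -0≈0 = FP.-0#≈0#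

  neg-zero : ∀ {x} → x ≈ 0# → - x ≈ 0#
  neg-zero p = F.trans (F.-‿cong p) -0≈0

  -- A flag Z ⊇ P₁ ⊇ … ⊇ P_r ⊆ B.  Each step is cut out by a linear
  -- relation rather than a linear map: this lets flags be pulled back along
  -- the zigzags of the long exact sequence without choosing representatives.
  data Dim≤ {X : Set} (B : Pred X) : Pred X → ℕ → Set (lsuc (c ⊔ ℓ)) where
    included : ∀ {Z} → (∀ {x} → Z x → B x) → Dim≤ B Z 0
    extend   : ∀ {Z P : Pred X} {r} (φ : (X → Carrier) → Carrier → Set (c ⊔ ℓ)) →
      (∀ {x y a b} l → φ x a → φ y b → φ (x +[ l ] y) (a ⊕ l ⊛ b)) →
      (∀ {x} → Z x → ∃ (φ x)) →
      (∀ {x a} → φ x a → a ≈ 0# → P x) →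
      Dim≤ B P r → Dim≤ B Z (suc r)

  module _ {X : Set} where

    Dim≤-⊆ˡ : ∀ {B Z Z′ : Pred X} {r} → (∀ {x} → Z x → Z′ x) → Dim≤ B Z′ r → Dim≤ B Z r
    Dim≤-⊆ˡ s (included t)         = included (t ∘ s)
    Dim≤-⊆ˡ s (extend φ lin tot ker D) = extend φ lin (tot ∘ s) ker D

    Dim≤-⊆ʳ : ∀ {B B′ Z : Pred X} {r} → (∀ {x} → B x → B′ x) → Dim≤ B Z r → Dim≤ B′ Z r
    Dim≤-⊆ʳ s (included t)         = included (s ∘ t)
    Dim≤-⊆ʳ s (extend φ lin tot ker D) = extend φ lin tot ker (Dim≤-⊆ʳ s D)

    Dim≤-trans : ∀ {B P Z : Pred X} {r s} → Dim≤ P Z r → Dim≤ B P s → Dim≤ B Z (r + s)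
    Dim≤-trans (included t)         E = Dim≤-⊆ˡ t E
    Dim≤-trans (extend φ lin tot ker D) E = extend φ lin tot ker (Dim≤-trans D E)

  -- Composing every step with `R` gives the new flag, its spaces being preimages under `R`. Since
  -- steps are relations anyway, `R` may be multivalued: only the bottom `B′` has to be reflected.
  Dim≤-pullback : {X Y : Set} {B Z : Pred X} {B′ Z′ : Pred Y} {r : ℕ}
    (R : (X → Carrier) → (Y → Carrier) → Set (c ⊔ ℓ)) →
    (∀ {x y x′ y′} a → R x x′ → R y y′ → R (x +[ a ] y) (x′ +[ a ] y′)) →
    (∀ {x} → Z x → ∃ λ x′ → R x x′ × Z′ x′) →
    (∀ {x x′} → R x x′ → B′ x′ → B x) →
    Dim≤ B′ Z′ r → Dim≤ B Z r
  Dim≤-pullback R lin tot refl′ (included t) =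
    included λ z → let _ , r , z′ = tot z in refl′ r (t z′)
  Dim≤-pullback R lin tot refl′ (extend {P = P} φ φ-lin φ-tot φ-ker D) =
    extend (λ x a → ∃ λ x′ → R x x′ × φ x′ a)
      (λ l (x′ , r , p) (y′ , s , q) → x′ +[ l ] y′ , lin l r s , φ-lin l p q)
      (λ z → let x′ , r , z′ = tot z ; a , p = φ-tot z′ in a , x′ , r , p)
      (λ (x′ , r , p) a≈0 → x′ , r , φ-ker p a≈0)
      (Dim≤-pullback {Z = λ x → ∃ λ x′ → R x x′ × P x′} R lin (λ z → z) refl′ D)

  record IsLinear {X Y : Set} (T : (X → Carrier) → (Y → Carrier)) : Set (c ⊔ ℓ) where
    field
      resp : ∀ {x y} → x ≋ y → T x ≋ T y
      comb : ∀ x a y → T (x +[ a ] y) ≋ T x +[ a ] T y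

    -- A vanishing x satisfies x = x + (-1)x, so `comb` gives T x = T x - T x.
    zero-≋ : ∀ {x} → (x ≋ λ _ → 0#) → T x ≋ λ _ → 0#
    zero-≋ {x} p t = begin
      T x t                       ≈⟨ resp (λ s → F.trans (p s) (F.sym (vanish (x s)))) t ⟩
      T (x +[ - 1# ] x) t         ≈⟨ comb x (- 1#) x t ⟩
      T x t ⊕ - 1# ⊛ T x t        ≈⟨ vanish (T x t) ⟩
      0#                          ∎
      where
      vanish : ∀ a → a ⊕ - 1# ⊛ a ≈ 0#
      vanish a = F.trans (F.+-congˡ (FP.-1*x≈-x a)) (F.-‿inverseʳ a)

    neg : ∀ x → T (λ s → - x s) ≋ λ t → - T x t
    neg x t = begin
      T (λ s → - x s) t                     ≈⟨ resp (λ s → F.trans (F.sym (FP.-1*x≈-x (x s))) (F.sym (F.+-identityˡ _))) t ⟩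
      T ((λ _ → 0#) +[ - 1# ] x) t          ≈⟨ comb _ _ _ t ⟩
      T (λ _ → 0#) t ⊕ - 1# ⊛ T x t         ≈⟨ F.+-cong (zero-≋ (λ _ → F.refl) t) (FP.-1*x≈-x _) ⟩
      0# ⊕ - T x t                          ≈⟨ F.+-identityˡ _ ⟩
      - T x t                               ∎

    add : ∀ x y → T (λ s → x s ⊕ y s) ≋ λ t → T x t ⊕ T y t
    add x y t = begin
      T (λ s → x s ⊕ y s) t   ≈⟨ resp (λ s → F.+-congˡ (F.sym (F.*-identityˡ _))) t ⟩
      T (x +[ 1# ] y) t       ≈⟨ comb _ _ _ t ⟩
      T x t ⊕ 1# ⊛ T y t      ≈⟨ F.+-congˡ (F.*-identityˡ _) ⟩
      T x t ⊕ T y t           ∎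

-- Boundary, wedge and contraction on the exterior algebra

module Operators {c ℓ : Level} (K : Field c ℓ) where
  open VectorSpace K
  open Field K using (Carrier; _≈_; 0#; 1#; -_) renaming (_+_ to _⊕_; _*_ to _⊛_)
  open SetoidReasoning F.setoid

  SetChain : ℕ → Set c
  SetChain n = Subset n → Carrier

  -- Splitting off the first vertex e as x = e ∧ x₁ + x₀, this is D x = x₁ - e ∧ D x₁ + D x₀. All
  -- sizes of subsets are treated at once, and the value at the empty set is the augmentation.
  D : ∀ {n} → SetChain n → SetChain n
  D x []          = 0#
  D x (true ∷ τ)  = - D (x ∘ (true ∷_)) τ
  D x (false ∷ τ) = x (true ∷ τ) ⊕ D (x ∘ (false ∷_)) τ

  -- On the exterior algebra with basis the vertices: x ↦ v ∧ x and its adjoint ι_v.  D is Σ_v ι_v.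
  wedge contract : ∀ {n} → Fin n → SetChain n → SetChain n
  wedge zero    x (true ∷ τ)  = x (false ∷ τ)
  wedge zero    x (false ∷ τ) = 0#
  wedge (suc v) x (true ∷ τ)  = - wedge v (x ∘ (true ∷_)) τ
  wedge (suc v) x (false ∷ τ) = wedge v (x ∘ (false ∷_)) τ
  contract zero    x (true ∷ τ)  = 0#
  contract zero    x (false ∷ τ) = x (true ∷ τ)
  contract (suc v) x (true ∷ τ)  = - contract v (x ∘ (true ∷_)) τ
  contract (suc v) x (false ∷ τ) = contract v (x ∘ (false ∷_)) τ

  private
    0-comb : ∀ a → 0# ≈ 0# ⊕ a ⊛ 0#
    0-comb a = F.sym (comb-zero a F.refl F.refl)

    neg-step : ∀ {x y z} a → x ≈ y ⊕ a ⊛ z → - x ≈ - y ⊕ a ⊛ (- z)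
    neg-step a p = F.trans (F.-‿cong p) (neg-comb _ _ a)

  D-linear : ∀ {n} → IsLinear (D {n})
  D-linear = record { resp = cg ; comb = cb }
    where
    cg : ∀ {n} {x y : SetChain n} → x ≋ y → D x ≋ D y
    cg p []          = F.refl
    cg p (true ∷ τ)  = F.-‿cong (cg (p ∘ (true ∷_)) τ)
    cg p (false ∷ τ) = F.+-cong (p (true ∷ τ)) (cg (p ∘ (false ∷_)) τ)
    cb : ∀ {n} (x : SetChain n) a y → D (x +[ a ] y) ≋ D x +[ a ] D y
    cb x a y []          = 0-comb a
    cb x a y (true ∷ τ)  = neg-step a (cb _ a _ τ)
    cb x a y (false ∷ τ) = F.trans (F.+-congˡ (cb _ a _ τ)) (comb-interchange _ _ _ _ a)

  wedge-linear : ∀ {n} (v : Fin n) → IsLinear (wedge v)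
  wedge-linear v = record { resp = cg v ; comb = cb v }
    where
    cg : ∀ {n} (v : Fin n) {x y : SetChain n} → x ≋ y → wedge v x ≋ wedge v y
    cg zero    p (true ∷ τ)  = p (false ∷ τ)
    cg zero    p (false ∷ τ) = F.refl
    cg (suc v) p (true ∷ τ)  = F.-‿cong (cg v (p ∘ (true ∷_)) τ)
    cg (suc v) p (false ∷ τ) = cg v (p ∘ (false ∷_)) τ
    cb : ∀ {n} (v : Fin n) (x : SetChain n) a y → wedge v (x +[ a ] y) ≋ wedge v x +[ a ] wedge v y
    cb zero    x a y (true ∷ τ)  = F.refl
    cb zero    x a y (false ∷ τ) = 0-comb a
    cb (suc v) x a y (true ∷ τ)  = neg-step a (cb v _ a _ τ)
    cb (suc v) x a y (false ∷ τ) = cb v _ a _ τ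

  contract-linear : ∀ {n} (v : Fin n) → IsLinear (contract v)
  contract-linear v = record { resp = cg v ; comb = cb v }
    where
    cg : ∀ {n} (v : Fin n) {x y : SetChain n} → x ≋ y → contract v x ≋ contract v y
    cg zero    p (true ∷ τ)  = F.refl
    cg zero    p (false ∷ τ) = p (true ∷ τ)
    cg (suc v) p (true ∷ τ)  = F.-‿cong (cg v (p ∘ (true ∷_)) τ)
    cg (suc v) p (false ∷ τ) = cg v (p ∘ (false ∷_)) τ
    cb : ∀ {n} (v : Fin n) (x : SetChain n) a y → contract v (x +[ a ] y) ≋ contract v x +[ a ] contract v y
    cb zero    x a y (true ∷ τ)  = 0-comb a
    cb zero    x a y (false ∷ τ) = F.refl
    cb (suc v) x a y (true ∷ τ)  = neg-step a (cb v _ a _ τ)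
    cb (suc v) x a y (false ∷ τ) = cb v _ a _ τ

  module Dˡ {n} = IsLinear (D-linear {n})
  module Wˡ {n} (v : Fin n) = IsLinear (wedge-linear v)
  module Cˡ {n} (v : Fin n) = IsLinear (contract-linear v)

  neg-neg : ∀ x → - (- x) ≈ x
  neg-neg = FP.-‿involutive

  D∘D≈0 : ∀ {n} (x : SetChain n) → D (D x) ≋ λ _ → 0#
  D∘D≈0 x [] = F.refl
  D∘D≈0 x (true ∷ τ) = neg-zero (F.trans (Dˡ.neg _ τ) (neg-zero (D∘D≈0 _ τ)))
  D∘D≈0 x (false ∷ τ) = begin
    - D x₁ τ ⊕ D (λ ρ → x₁ ρ ⊕ D x₀ ρ) τ   ≈⟨ F.+-congˡ (Dˡ.add _ _ τ) ⟩
    - D x₁ τ ⊕ (D x₁ τ ⊕ D (D x₀) τ)       ≈⟨ F.+-assoc _ _ _ ⟨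
    (- D x₁ τ ⊕ D x₁ τ) ⊕ D (D x₀) τ       ≈⟨ F.+-cong (F.-‿inverseˡ _) (D∘D≈0 x₀ τ) ⟩
    0# ⊕ 0#                                ≈⟨ F.+-identityˡ _ ⟩
    0#                                     ∎
    where x₁ = x ∘ (true ∷_) ; x₀ = x ∘ (false ∷_)

  -- The contractions anticommute and `D` is their sum. Hence contraction by `v` sends cycles to
  -- cycles, which makes it the map to the link.
  D∘contract : ∀ {n} (v : Fin n) (x : SetChain n) → D (contract v x) ≋ λ τ → - contract v (D x) τ
  D∘contract zero x (true ∷ τ)  = F.-‿cong (Dˡ.zero-≋ (λ _ → F.refl) τ)
  D∘contract zero x (false ∷ τ) = F.trans (F.+-identityˡ _) (F.sym (neg-neg _))
  D∘contract (suc v) x (true ∷ τ) = F.-‿cong (begin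
    D (λ ρ → - contract v x₁ ρ) τ     ≈⟨ Dˡ.neg _ τ ⟩
    - D (contract v x₁) τ             ≈⟨ F.-‿cong (D∘contract v x₁ τ) ⟩
    - (- contract v (D x₁) τ)         ≈⟨ F.-‿cong (Cˡ.neg v _ τ) ⟨
    - contract v (λ ρ → - D x₁ ρ) τ   ∎)
    where x₁ = x ∘ (true ∷_)
  D∘contract (suc v) x (false ∷ τ) = begin
    - contract v x₁ τ ⊕ D (contract v x₀) τ       ≈⟨ F.+-congˡ (D∘contract v x₀ τ) ⟩
    - contract v x₁ τ ⊕ - contract v (D x₀) τ     ≈⟨ FP.-‿+-comm _ _ ⟩
    - (contract v x₁ τ ⊕ contract v (D x₀) τ)     ≈⟨ F.-‿cong (Cˡ.add v _ _ τ) ⟨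
    - contract v (λ ρ → x₁ ρ ⊕ D x₀ ρ) τ          ∎
    where x₁ = x ∘ (true ∷_) ; x₀ = x ∘ (false ∷_)

  -- Summed over u, this is ι_u(v ∧ x) = δ_uv x - v ∧ ι_u x. Wedging with `v` is thus a contracting
  -- homotopy; it fills cycles in cones and moves cycles off `v`.
  D∘wedge : ∀ {n} (v : Fin n) (x : SetChain n) → (λ τ → D (wedge v x) τ ⊕ wedge v (D x) τ) ≋ x
  D∘wedge zero x (true ∷ τ) = begin
    - D x₀ τ ⊕ (x₁ τ ⊕ D x₀ τ)   ≈⟨ F.+-congˡ (F.+-comm _ _) ⟩
    - D x₀ τ ⊕ (D x₀ τ ⊕ x₁ τ)   ≈⟨ F.+-assoc _ _ _ ⟨
    (- D x₀ τ ⊕ D x₀ τ) ⊕ x₁ τ   ≈⟨ F.+-congʳ (F.-‿inverseˡ _) ⟩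
    0# ⊕ x₁ τ                    ≈⟨ F.+-identityˡ _ ⟩
    x₁ τ                         ∎
    where x₁ = x ∘ (true ∷_) ; x₀ = x ∘ (false ∷_)
  D∘wedge zero x (false ∷ τ) = F.trans (F.+-identityʳ _)
    (F.trans (F.+-congˡ (Dˡ.zero-≋ (λ _ → F.refl) τ)) (F.+-identityʳ _))
  D∘wedge (suc v) x (true ∷ τ) = begin
    - D (λ ρ → - wedge v x₁ ρ) τ ⊕ - wedge v (λ ρ → - D x₁ ρ) τ
      ≈⟨ F.+-cong (F.-‿cong (Dˡ.neg _ τ)) (F.-‿cong (Wˡ.neg v _ τ)) ⟩
    - (- D (wedge v x₁) τ) ⊕ - (- wedge v (D x₁) τ)
      ≈⟨ F.+-cong (neg-neg _) (neg-neg _) ⟩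
    D (wedge v x₁) τ ⊕ wedge v (D x₁) τ
      ≈⟨ D∘wedge v x₁ τ ⟩
    x₁ τ ∎
    where x₁ = x ∘ (true ∷_)
  D∘wedge (suc v) x (false ∷ τ) = begin
    (- wedge v x₁ τ ⊕ D (wedge v x₀) τ) ⊕ wedge v (λ ρ → x₁ ρ ⊕ D x₀ ρ) τ
      ≈⟨ F.+-congˡ (Wˡ.add v _ _ τ) ⟩
    (- wedge v x₁ τ ⊕ D (wedge v x₀) τ) ⊕ (wedge v x₁ τ ⊕ wedge v (D x₀) τ)
      ≈⟨ interchange _ _ _ _ ⟩
    (- wedge v x₁ τ ⊕ wedge v x₁ τ) ⊕ (D (wedge v x₀) τ ⊕ wedge v (D x₀) τ)
      ≈⟨ F.+-cong (F.-‿inverseˡ _) (D∘wedge v x₀ τ) ⟩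
    0# ⊕ x₀ τ
      ≈⟨ F.+-identityˡ _ ⟩
    x₀ τ ∎
    where x₁ = x ∘ (true ∷_) ; x₀ = x ∘ (false ∷_)

  wedge∘contract-∈ : ∀ {n} (v : Fin n) (x : SetChain n) σ → lookup σ v ≡ true →
    wedge v (contract v x) σ ≈ x σ
  wedge∘contract-∈ zero    x (true ∷ σ)  p = F.refl
  wedge∘contract-∈ (suc v) x (false ∷ σ) p = wedge∘contract-∈ v _ σ p
  wedge∘contract-∈ (suc v) x (true ∷ σ)  p = begin
    - wedge v (λ ρ → - contract v x₁ ρ) σ   ≈⟨ F.-‿cong (Wˡ.neg v _ σ) ⟩
    - (- wedge v (contract v x₁) σ)         ≈⟨ neg-neg _ ⟩
    wedge v (contract v x₁) σ               ≈⟨ wedge∘contract-∈ v x₁ σ p ⟩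
    x₁ σ                                    ∎
    where x₁ = x ∘ (true ∷_)

  wedge-∉ : ∀ {n} (v : Fin n) (x : SetChain n) σ → lookup σ v ≡ false → wedge v x σ ≈ 0#
  wedge-∉ zero    x (false ∷ σ) p = F.refl
  wedge-∉ (suc v) x (true ∷ σ)  p = neg-zero (wedge-∉ v _ σ p)
  wedge-∉ (suc v) x (false ∷ σ) p = wedge-∉ v _ σ p

  wedge-zero : ∀ {n} (v : Fin n) (x : SetChain n) σ → lookup σ v ≡ true →
    x (σ [ v ]≔ false) ≈ 0# → wedge v x σ ≈ 0#
  wedge-zero zero    x (true ∷ σ)  p q = q
  wedge-zero (suc v) x (true ∷ σ)  p q = neg-zero (wedge-zero v _ σ p q)
  wedge-zero (suc v) x (false ∷ σ) p q = wedge-zero v _ σ p q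

  contract-∈ : ∀ {n} (v : Fin n) (x : SetChain n) σ → lookup σ v ≡ true → contract v x σ ≈ 0#
  contract-∈ zero    x (true ∷ σ)  p = F.refl
  contract-∈ (suc v) x (true ∷ σ)  p = neg-zero (contract-∈ v _ σ p)
  contract-∈ (suc v) x (false ∷ σ) p = contract-∈ v _ σ p

  contract-zero : ∀ {n} (v : Fin n) (x : SetChain n) σ → lookup σ v ≡ false →
    x (σ [ v ]≔ true) ≈ 0# → contract v x σ ≈ 0#
  contract-zero zero    x (false ∷ σ) p q = q
  contract-zero (suc v) x (true ∷ σ)  p q = neg-zero (contract-zero v _ σ p q)
  contract-zero (suc v) x (false ∷ σ) p q = contract-zero v _ σ p q

  D-zero : ∀ {n} (x : SetChain n) τ → (∀ v → lookup τ v ≡ false → x (τ [ v ]≔ true) ≈ 0#) →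
    D x τ ≈ 0#
  D-zero x []          p = F.refl
  D-zero x (true ∷ τ)  p = neg-zero (D-zero _ τ (p ∘ suc))
  D-zero x (false ∷ τ) p = F.trans (F.+-cong (p zero _≡_.refl) (D-zero _ τ (p ∘ suc))) (F.+-identityˡ _)

-- Faces under insertion and deletion of a vertex

card-insert : ∀ {n} (v : Fin n) τ → lookup τ v ≡ false → card (τ [ v ]≔ true) ≡ suc (card τ)
card-insert zero    (false ∷ τ) p = refl
card-insert (suc v) (true ∷ τ)  p = cong suc (card-insert v τ p)
card-insert (suc v) (false ∷ τ) p = card-insert v τ p

card-delete : ∀ {n} (v : Fin n) σ → lookup σ v ≡ true → card σ ≡ suc (card (σ [ v ]≔ false))
card-delete zero    (true ∷ τ)  p = refl
card-delete (suc v) (true ∷ τ)  p = cong suc (card-delete v τ p)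
card-delete (suc v) (false ∷ τ) p = card-delete v τ p

lookup-insert : ∀ {n} (v : Fin n) (τ : Subset n) i → lookup τ i ≡ true → lookup (τ [ v ]≔ true) i ≡ true
lookup-insert v τ i p with i ≟ v
... | yes refl = lookup∘update v τ true
... | no i≢v   = trans (lookup∘update′ i≢v τ true) p

∌⇒≢ : ∀ {n} {τ : Subset n} {v i} → lookup τ v ≡ false → lookup τ i ≡ true → i ≢ v
∌⇒≢ p q refl with trans (sym p) q
... | ()

not-true : ∀ {b} → not b ≡ true → b ≡ false
not-true {false} p = refl

VertexSet : ℕ → Set
VertexSet n = Fin n → Bool

infixl 6 _∖_
_∖_ : ∀ {n} → VertexSet n → Fin n → VertexSet n
(S ∖ v) i = S i ∧ not (does (i ≟ v))

∖⁻ : ∀ {n} (S : VertexSet n) v i → (S ∖ v) i ≡ true → S i ≡ true × i ≢ v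
∖⁻ S v i p with i ≟ v
... | no i≢v = ∧-conicalˡ _ _ p , i≢v
... | yes _ with ∧-conicalʳ (S i) false p
... | ()

∖⁺ : ∀ {n} (S : VertexSet n) v i → S i ≡ true → i ≢ v → (S ∖ v) i ≡ true
∖⁺ S v i p i≢v with i ≟ v
... | yes i≡v = contradiction i≡v i≢v
... | no _ rewrite p = refl

module Neighbourhood {n : ℕ} (G : Graph n) where
  open Graph G using (adj)

  nonadjacent : VertexSet n → Fin n → VertexSet n
  nonadjacent S v i = S i ∧ not (adj v i)

  infixl 6 _∖N[_]
  _∖N[_] : VertexSet n → Fin n → VertexSet n
  S ∖N[ v ] = nonadjacent S v ∖ v

  ∖N⁻ : ∀ S v i → (S ∖N[ v ]) i ≡ true → S i ≡ true × i ≢ v × adj v i ≡ false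
  ∖N⁻ S v i p = let q , i≢v = ∖⁻ (nonadjacent S v) v i p in
    ∧-conicalˡ (S i) _ q , i≢v , not-true (∧-conicalʳ (S i) _ q)

  ∖N⁺ : ∀ S v i → S i ≡ true → i ≢ v → adj v i ≡ false → (S ∖N[ v ]) i ≡ true
  ∖N⁺ S v i p i≢v q = ∖⁺ (nonadjacent S v) v i lem i≢v
    where
    lem : nonadjacent S v i ≡ true
    lem rewrite p | q = refl

  record Face (S : VertexSet n) (k : ℕ) (σ : Subset n) : Set where
    field
      within : ∀ i → lookup σ i ≡ true → S i ≡ true
      indep  : ∀ i j → lookup σ i ≡ true → lookup σ j ≡ true → adj i j ≡ false
      size   : card σ ≡ k
  open Face

  Face-⊆ : ∀ {S S′ k σ} → (∀ i → S i ≡ true → S′ i ≡ true) → Face S k σ → Face S′ k σ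
  Face-⊆ S⊆S′ f = record { within = λ i p → S⊆S′ i (within f i p) ; indep = indep f ; size = size f }

  Face-delete : ∀ {S k} v τ → lookup τ v ≡ false → Face S (suc k) (τ [ v ]≔ true) → Face S k τ
  Face-delete v τ v∉τ f = record
    { within = λ i p → within f i (lookup-insert v τ i p)
    ; indep  = λ i j p q → indep f i j (lookup-insert v τ i p) (lookup-insert v τ j q)
    ; size   = suc-injective (trans (sym (card-insert v τ v∉τ)) (size f)) }

  Face-link : ∀ {S k} v τ → lookup τ v ≡ false → Face S (suc k) (τ [ v ]≔ true) → Face (S ∖N[ v ]) k τ
  Face-link {S} v τ v∉τ f = record
    { within = λ i p → ∖N⁺ S v i (within f′ i p) (∌⇒≢ {τ = τ} v∉τ p)
                         (indep f v i (lookup∘update v τ true) (lookup-insert v τ i p))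
    ; indep  = indep f′
    ; size   = size f′ }
    where f′ = Face-delete v τ v∉τ f

  -- The set `L` is left free for two uses: `S` itself when `v` is isolated, and the vertices
  -- outside the closed neighbourhood when chains of the link are coned off.
  Face-cone : ∀ {S L k} v σ → S v ≡ true → (∀ i → L i ≡ true → S i ≡ true × adj v i ≡ false) →
    lookup σ v ≡ true → Face L k (σ [ v ]≔ false) → Face S (suc k) σ
  Face-cone {S} {L} v σ v∈S L⊆ v∈σ f = record
    { within = wi ; indep = ind ; size = trans (card-delete v σ v∈σ) (cong suc (size f)) }
    where
    keep : ∀ {i} → i ≢ v → lookup σ i ≡ true → lookup (σ [ v ]≔ false) i ≡ true
    keep i≢v p = trans (lookup∘update′ i≢v σ false) p
    wi : ∀ i → lookup σ i ≡ true → S i ≡ true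
    wi i p with i ≟ v
    ... | yes refl = v∈S
    ... | no i≢v   = proj₁ (L⊆ i (within f i (keep i≢v p)))
    ind : ∀ i j → lookup σ i ≡ true → lookup σ j ≡ true → adj i j ≡ false
    ind i j p q with i ≟ v | j ≟ v
    ... | yes refl | yes refl = Graph.irrefl G v
    ... | yes refl | no j≢v   = proj₂ (L⊆ j (within f j (keep j≢v q)))
    ... | no i≢v   | yes refl = trans (Graph.sym G i v) (proj₂ (L⊆ i (within f i (keep i≢v p))))
    ... | no i≢v   | no j≢v   = indep f i j (keep i≢v p) (keep j≢v q)

-- Homology of induced subcomplexes: cones, deletion and link, the empty complex

module Complex {c ℓ : Level} (K : Field c ℓ) {n : ℕ} (G : Graph n) where
  open VectorSpace K
  open Operators K
  open Neighbourhood G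
  open Graph G using (adj)
  open Field K using (Carrier; _≈_; 0#; 1#; -_) renaming (_+_ to _⊕_; _*_ to _⊛_)
  open SetoidReasoning F.setoid

  Supported : VertexSet n → ℕ → SetChain n → Set ℓ
  Supported S k x = ∀ σ → ¬ Face S k σ → x σ ≈ 0#

  record IsCycle (S : VertexSet n) (k : ℕ) (x : SetChain n) : Set (c ⊔ ℓ) where
    field
      supported : Supported S k x
      closed    : D x ≋ λ _ → 0#
  open IsCycle

  IsBoundary : VertexSet n → ℕ → SetChain n → Set (c ⊔ ℓ)
  IsBoundary S k x = ∃ λ w → Supported S (suc k) w × D w ≋ x

  Supported-⊆ : ∀ {S S′ k x} → (∀ i → S i ≡ true → S′ i ≡ true) → Supported S k x → Supported S′ k x
  Supported-⊆ s p σ ¬f = p σ (¬f ∘ Face-⊆ s)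

  Supported-comb : ∀ {S k x y} a → Supported S k x → Supported S k y → Supported S k (x +[ a ] y)
  Supported-comb a p q σ ¬f = comb-zero a (p σ ¬f) (q σ ¬f)

  IsCycle-comb : ∀ {S k x y} a → IsCycle S k x → IsCycle S k y → IsCycle S k (x +[ a ] y)
  IsCycle-comb {x = x} {y} a p q = record
    { supported = Supported-comb a (supported p) (supported q)
    ; closed    = λ τ → F.trans (Dˡ.comb x a y τ) (comb-zero a (closed p τ) (closed q τ)) }

  HomologyDim≤ : VertexSet n → ℕ → ℕ → Set (lsuc (c ⊔ ℓ))
  HomologyDim≤ S k r = Dim≤ (IsBoundary S k) (IsCycle S k) r

  wedge-supported : ∀ {S L k x} v → S v ≡ true →
    (∀ i → L i ≡ true → S i ≡ true × adj v i ≡ false) →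
    Supported L k x → Supported S (suc k) (wedge v x)
  wedge-supported {x = x} v v∈S L⊆ p σ ¬f with lookup σ v in eq
  ... | true  = wedge-zero v x σ eq (p (σ [ v ]≔ false) (¬f ∘ Face-cone v σ v∈S L⊆ eq))
  ... | false = wedge-∉ v x σ eq

  -- As D x = 0, the homotopy formula reads x = D(v ∧ x), and v ∧ x stays inside the complex because
  -- `v` may be added to any face.
  cone-acyclic : ∀ {S} v → S v ≡ true → (∀ i → S i ≡ true → adj v i ≡ false) →
    ∀ k → HomologyDim≤ S k 0
  cone-acyclic v v∈S isolated k = included λ {x} z →
    wedge v x ,
    wedge-supported v v∈S (λ i p → p , isolated i p) (supported z) ,
    λ σ → begin
      D (wedge v x) σ                          ≈⟨ F.+-identityʳ _ ⟨
      D (wedge v x) σ ⊕ 0#                     ≈⟨ F.+-congˡ (Wˡ.zero-≋ v (closed z) σ) ⟨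
      D (wedge v x) σ ⊕ wedge v (D x) σ        ≈⟨ D∘wedge v x σ ⟩
      x σ                                      ∎

  module _ (S : VertexSet n) (v : Fin n) (v∈S : S v ≡ true) where

    private
      A L : VertexSet n
      A = S ∖ v
      L = S ∖N[ v ]

      L⊆S : ∀ i → L i ≡ true → S i ≡ true × adj v i ≡ false
      L⊆S i p = let q , _ , r = ∖N⁻ S v i p in q , r

      L⊆A : ∀ i → L i ≡ true → A i ≡ true
      L⊆A i p = let q , i≢v , _ = ∖N⁻ S v i p in ∖⁺ S v i q i≢v

      A⊆S : ∀ i → A i ≡ true → S i ≡ true
      A⊆S i p = proj₁ (∖⁻ S v i p)

      Face-∖ : ∀ {k} σ → lookup σ v ≡ false → Face S k σ → Face A k σ
      Face-∖ σ v∉σ f = record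
        { within = λ i p → ∖⁺ S v i (Face.within f i p) (∌⇒≢ {τ = σ} v∉σ p)
        ; indep = Face.indep f ; size = Face.size f }

      v∉Face : ∀ {k T} σ → (∀ i → T i ≡ true → i ≢ v) → lookup σ v ≡ true → ¬ Face T k σ
      v∉Face σ p v∈σ f = p v (Face.within f v v∈σ) refl

      contract-supported : ∀ {k x} → Supported S (suc k) x → Supported L k (contract v x)
      contract-supported {x = x} p τ ¬f with lookup τ v in eq
      ... | true  = contract-∈ v x τ eq
      ... | false = contract-zero v x τ eq (p (τ [ v ]≔ true) (¬f ∘ Face-link v τ eq))

      contract-cycle : ∀ {k x} → IsCycle S (suc k) x → IsCycle L k (contract v x)
      contract-cycle {x = x} z = record
        { supported = contract-supported (supported z)
        ; closed    = λ τ → F.trans (D∘contract v x τ) (neg-zero (Cˡ.zero-≋ v (closed z) τ)) }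

      -- The kernel of the map from the homology of `S` to that of the link, one degree lower: the
      -- middle space where the two flags are joined.
      LinkBounds : ℕ → Pred (Subset n)
      LinkBounds k x = IsCycle S (suc k) x × IsBoundary L k (contract v x)

      toLink : ∀ {k r} → HomologyDim≤ L k r → Dim≤ (LinkBounds k) (IsCycle S (suc k)) r
      toLink {k} = Dim≤-pullback (λ x x′ → IsCycle S (suc k) x × x′ ≋ contract v x)
        (λ {x} {y} a (z , p) (z′ , q) → IsCycle-comb a z z′ ,
          λ σ → F.trans (comb-cong a (p σ) (q σ)) (F.sym (Cˡ.comb v x a y σ)))
        (λ {x} z → contract v x , (z , λ _ → F.refl) , contract-cycle z)
        (λ (z , p) (w , s , q) → z , w , s , λ σ → F.trans (q σ) (p σ))

      -- The class of x′ in the deletion is determined by x only up to the kernel of H(A) → H(S),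
      -- which is why a relation is used and not a map.
      Homologous : ℕ → SetChain n → SetChain n → Set (c ⊔ ℓ)
      Homologous k x x′ = ∃ λ w → Supported S (suc k) w × (x ≋ λ σ → x′ σ ⊕ D w σ)

      Homologous-comb : ∀ {k x y x′ y′} a → Homologous k x x′ → Homologous k y y′ →
        Homologous k (x +[ a ] y) (x′ +[ a ] y′)
      Homologous-comb a (w , s , p) (w′ , s′ , q) =
        w +[ a ] w′ , Supported-comb a s s′ , λ σ → F.trans (comb-cong a (p σ) (q σ))
          (F.trans (F.sym (comb-interchange _ _ _ _ a)) (F.+-congˡ (F.sym (Dˡ.comb w a w′ σ))))

      Homologous-boundary : ∀ {k x x′} → Homologous k x x′ → IsBoundary A k x′ → IsBoundary S k x
      Homologous-boundary (w , s , p) (u , t , q) =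
        (λ σ → u σ ⊕ w σ) ,
        (λ σ ¬f → F.trans (F.+-cong (Supported-⊆ A⊆S t σ ¬f) (s σ ¬f)) (F.+-identityˡ _)) ,
        λ σ → F.trans (Dˡ.add u w σ) (F.trans (F.+-congʳ (q σ)) (F.sym (p σ)))

      -- If ∂w = ι_v x then x + ∂(v ∧ w) = (x − v ∧ ι_v x) + w avoids v.
      push : ∀ {k x} → LinkBounds k x → ∃ λ x′ → Homologous (suc k) x x′ × IsCycle A (suc k) x′
      push {k} {x} (z , w , s , p) = x′ , (W , W-supported , homologous) , record
        { supported = supported′ ; closed = closed′ }
        where
        x′ W : SetChain n
        x′ σ = x σ ⊕ D (wedge v w) σ
        W σ = - wedge v w σ

        W-supported : Supported S (suc (suc k)) W
        W-supported σ ¬f = neg-zero (wedge-supported v v∈S L⊆S s σ ¬f)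

        homologous : x ≋ λ σ → x′ σ ⊕ D W σ
        homologous σ = F.sym (begin
          (x σ ⊕ D (wedge v w) σ) ⊕ D W σ                  ≈⟨ F.+-congˡ (Dˡ.neg _ σ) ⟩
          (x σ ⊕ D (wedge v w) σ) ⊕ - D (wedge v w) σ      ≈⟨ F.+-assoc _ _ _ ⟩
          x σ ⊕ (D (wedge v w) σ ⊕ - D (wedge v w) σ)      ≈⟨ F.+-congˡ (F.-‿inverseʳ _) ⟩
          x σ ⊕ 0#                                         ≈⟨ F.+-identityʳ _ ⟩
          x σ                                              ∎)

        closed′ : D x′ ≋ λ _ → 0#
        closed′ σ = F.trans (Dˡ.add _ _ σ)
          (F.trans (F.+-cong (closed z σ) (D∘D≈0 _ σ)) (F.+-identityˡ _))

        key : ∀ σ → D (wedge v w) σ ⊕ wedge v (contract v x) σ ≈ w σ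
        key σ = F.trans (F.+-congˡ (F.sym (Wˡ.resp v p σ))) (D∘wedge v w σ)

        supported′ : Supported A (suc k) x′
        supported′ σ ¬f with lookup σ v in eq
        -- On sets containing `v` the chain v ∧ ι_v x agrees with x, so x′ agrees with w, and w
        -- lives in the link, which avoids `v`.
        ... | true = begin
          x σ ⊕ D (wedge v w) σ                        ≈⟨ F.+-comm _ _ ⟩
          D (wedge v w) σ ⊕ x σ                        ≈⟨ F.+-congˡ (wedge∘contract-∈ v x σ eq) ⟨
          D (wedge v w) σ ⊕ wedge v (contract v x) σ   ≈⟨ key σ ⟩
          w σ                                          ≈⟨ s σ (v∉Face σ (λ i q → proj₁ (proj₂ (∖N⁻ S v i q))) eq) ⟩
          0#                                           ∎
        -- On sets without `v` the wedge term is zero, so x′ agrees with x + w, and neither x nor w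
        -- is supported at a set that is no face of the deletion.
        ... | false = begin
          x σ ⊕ D (wedge v w) σ                            ≈⟨ F.+-cong (supported z σ (¬f ∘ Face-∖ σ eq)) (F.sym (F.+-identityʳ _)) ⟩
          0# ⊕ (D (wedge v w) σ ⊕ 0#)                      ≈⟨ F.+-identityˡ _ ⟩
          D (wedge v w) σ ⊕ 0#                             ≈⟨ F.+-congˡ (wedge-∉ v _ σ eq) ⟨
          D (wedge v w) σ ⊕ wedge v (contract v x) σ       ≈⟨ key σ ⟩
          w σ                                              ≈⟨ s σ (¬f ∘ Face-⊆ L⊆A) ⟩
          0#                                               ∎

      fromDeletion : ∀ {k r} → HomologyDim≤ A (suc k) r → Dim≤ (IsBoundary S (suc k)) (LinkBounds k) r
      fromDeletion = Dim≤-pullback (Homologous _) Homologous-comb push Homologous-boundary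

    -- Exactness of H(S ∖ v) → H(S) → H(S ∖ N[v])[−1] at the middle term.
    deletion-link-suc : ∀ {k a l} → HomologyDim≤ (S ∖ v) (suc k) a → HomologyDim≤ (S ∖N[ v ]) k l →
      HomologyDim≤ S (suc k) (a + l)
    deletion-link-suc {k} {a} {l} dA dL =
      subst (HomologyDim≤ S (suc k)) (+-comm l a) (Dim≤-trans (toLink dL) (fromDeletion dA))

    -- A face with no vertices cannot contain `v`, so the link contributes nothing here. The summand
    -- 0 is the value of `shift` at this index.
    deletion-link-zero : ∀ {a} → HomologyDim≤ (S ∖ v) 0 a → HomologyDim≤ S 0 (a + 0)
    deletion-link-zero {a} dA = subst (HomologyDim≤ S 0) (+-comm 0 a)
      (Dim≤-⊆ˡ restrict (Dim≤-⊆ʳ (λ (w , s , p) → w , Supported-⊆ A⊆S s , p) dA))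
      where
      restrict : ∀ {x} → IsCycle S 0 x → IsCycle A 0 x
      restrict {x} z = record { supported = supp ; closed = closed z }
        where
        supp : Supported A 0 x
        supp σ ¬f with lookup σ v in eq
        ... | false = supported z σ (¬f ∘ Face-∖ σ eq)
        ... | true  = supported z σ λ f →
          contradiction (trans (sym (card-delete v σ eq)) (Face.size f)) λ ()

  module _ (S : VertexSet n) (S-empty : ∀ i → S i ≡ false) where

    private
      Face-empty : ∀ {k σ} → Face S k σ → σ ≡ replicate n false
      Face-empty f = empty (λ i p → S∌ i (Face.within f i p))
        where
        S∌ : ∀ i → ¬ S i ≡ true
        S∌ i p with trans (sym p) (S-empty i)
        ... | ()
        empty : ∀ {m} {σ : Subset m} → (∀ i → ¬ lookup σ i ≡ true) → σ ≡ replicate m false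
        empty {σ = []} p = refl
        empty {σ = true ∷ σ} p = ⊥-elim (p zero refl)
        empty {σ = false ∷ σ} p = cong (false ∷_) (empty (p ∘ suc))

      card-empty : ∀ m → card (replicate m false) ≡ 0
      card-empty zero = refl
      card-empty (suc m) = card-empty m

      vanishing : ∀ {k x} → x ≋ (λ _ → 0#) → IsBoundary S k x
      vanishing p = (λ _ → 0#) , (λ _ _ → F.refl) ,
        λ σ → F.trans (Dˡ.zero-≋ (λ _ → F.refl) σ) (F.sym (p σ))

    empty-dim-suc : ∀ k → HomologyDim≤ S (suc k) 0
    empty-dim-suc k = included λ {x} z → vanishing λ σ → supported z σ λ f →
      contradiction (trans (sym (Face.size f)) (trans (cong card (Face-empty f)) (card-empty n))) λ ()

    -- The empty set is the only face, so evaluation there is the one linear form needed; this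
    -- accounts for the convention that the empty complex has Betti number 1.
    empty-dim-zero : HomologyDim≤ S 0 1
    empty-dim-zero = extend {P = λ x → IsBoundary S 0 x}
      (λ x a → IsCycle S 0 x × x ∅ ≈ a)
      (λ l (z , p) (z′ , q) → IsCycle-comb l z z′ , comb-cong l p q)
      (λ {x} z → x ∅ , z , F.refl)
      (λ {x} (z , p) a≈0 → vanishing (van x z (F.trans p a≈0)))
      (included λ b → b)
      where
      ∅ = replicate n false
      van : ∀ x → IsCycle S 0 x → x ∅ ≈ 0# → x ≋ λ _ → 0#
      van x z p σ with ≡-dec Bool._≟_ σ ∅
      ... | yes refl = p
      ... | no σ≢∅   = supported z σ (σ≢∅ ∘ Face-empty)

-- Enumerating subsets, and the boundary map as a sum over them

¬¬-∀Fin : ∀ {p m} {P : Fin m → Set p} → (∀ t → ¬ ¬ P t) → ¬ ¬ (∀ t → P t)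
¬¬-∀Fin {m = zero}  p k = k λ ()
¬¬-∀Fin {m = suc m} p k = p zero λ p₀ → ¬¬-∀Fin (p ∘ suc) λ ps →
  k λ { zero → p₀ ; (suc t) → ps t }

allB⁺ : ∀ {A : Set} {p : A → Bool} {xs} → (∀ x → T (p x)) → T (allB p xs)
allB⁺ {xs = []}     h = _
allB⁺ {xs = x ∷ xs} h = Equivalence.from T-∧ (h x , allB⁺ {xs = xs} h)

allB⁻ : ∀ {A : Set} {p : A → Bool} {xs x} → T (allB p xs) → x ∈ xs → T (p x)
allB⁻ h (here refl) = proj₁ (Equivalence.to T-∧ h)
allB⁻ {p = p} {xs = y ∷ _} h (there x∈) = allB⁻ (proj₂ (Equivalence.to (T-∧ {p y}) h)) x∈

allSubsets-complete : ∀ {n} (σ : Subset n) → σ ∈ allSubsets n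
allSubsets-complete []          = here refl
allSubsets-complete (true ∷ σ)  = ∈-++⁺ˡ (∈-map⁺ _ (allSubsets-complete σ))
allSubsets-complete (false ∷ σ) = ∈-++⁺ʳ _ (∈-map⁺ _ (allSubsets-complete σ))

allSubsets-unique : ∀ n → Unique (allSubsets n)
allSubsets-unique zero    = [] ∷ []
allSubsets-unique (suc n) =
  ++⁺ (map⁺ ∷-injectiveʳ (allSubsets-unique n)) (map⁺ ∷-injectiveʳ (allSubsets-unique n)) disjoint
  where
  disjoint : ∀ {σ} → ¬ (σ ∈ map (true ∷_) (allSubsets n) × σ ∈ map (false ∷_) (allSubsets n))
  disjoint (p , q) with ∈-map⁻ (true ∷_) p | ∈-map⁻ (false ∷_) q
  ... | _ , _ , refl | _ , _ , ()

lookup-injective : ∀ {A : Set} {xs : List A} → Unique xs → ∀ i j →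
  List.lookup xs i ≡ List.lookup xs j → i ≡ j
lookup-injective (_ ∷ _)  zero    zero    p = refl
lookup-injective (x≢ ∷ _) zero    (suc j) p = contradiction p (All.lookup x≢ (∈-lookup j))
lookup-injective (x≢ ∷ _) (suc i) zero    p = contradiction (sym p) (All.lookup x≢ (∈-lookup i))
lookup-injective (_ ∷ u)  (suc i) (suc j) p = cong suc (lookup-injective u i j p)

module Boundary-as-sum {c ℓ : Level} (K : Field c ℓ) where
  open VectorSpace K
  open Operators K
  open Field K using (Carrier; _≈_; 0#; 1#; -_) renaming (_+_ to _⊕_; _*_ to _⊛_)
  open SetoidReasoning F.setoid

  sumOver : {A : Set} → List A → (A → Carrier) → Carrier
  sumOver []       g = 0#
  sumOver (x ∷ xs) g = g x ⊕ sumOver xs g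

  module _ {A : Set} where

    sumOver-cong : ∀ (xs : List A) {g h : A → Carrier} → g ≋ h → sumOver xs g ≈ sumOver xs h
    sumOver-cong []       p = F.refl
    sumOver-cong (x ∷ xs) p = F.+-cong (p x) (sumOver-cong xs p)

    sumOver-zero : ∀ (xs : List A) {g : A → Carrier} → (g ≋ λ _ → 0#) → sumOver xs g ≈ 0#
    sumOver-zero []       p = F.refl
    sumOver-zero (x ∷ xs) p = F.trans (F.+-cong (p x) (sumOver-zero xs p)) (F.+-identityˡ _)

    sumOver-neg : ∀ (xs : List A) (g : A → Carrier) → sumOver xs (λ x → - g x) ≈ - sumOver xs g
    sumOver-neg []       g = F.sym -0≈0
    sumOver-neg (x ∷ xs) g = F.trans (F.+-congˡ (sumOver-neg xs g)) (FP.-‿+-comm _ _)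

    sumOver-++ : ∀ (xs ys : List A) (g : A → Carrier) → sumOver (xs ++ ys) g ≈ sumOver xs g ⊕ sumOver ys g
    sumOver-++ []       ys g = F.sym (F.+-identityˡ _)
    sumOver-++ (x ∷ xs) ys g = F.trans (F.+-congˡ (sumOver-++ xs ys g)) (F.sym (F.+-assoc _ _ _))

    sumOver-map : ∀ {B : Set} (f : B → A) xs (g : A → Carrier) → sumOver (map f xs) g ≈ sumOver xs (g ∘ f)
    sumOver-map f []       g = F.refl
    sumOver-map f (x ∷ xs) g = F.+-congˡ (sumOver-map f xs g)

    sumOver-filter : ∀ {P : A → Set} (P? : ∀ x → Dec (P x)) xs {g : A → Carrier} →
      (∀ x → ¬ P x → g x ≈ 0#) → sumOver (filter P? xs) g ≈ sumOver xs g
    sumOver-filter P? []       z = F.refl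
    sumOver-filter P? (x ∷ xs) z with P? x
    ... | yes _ = F.+-congˡ (sumOver-filter P? xs z)
    ... | no ¬p = F.trans (sumOver-filter P? xs z)
                    (F.sym (F.trans (F.+-congʳ (z x ¬p)) (F.+-identityˡ _)))

  -- The incidence number with its sign built up along the recursion: each common vertex passed over
  -- flips it. In this form it follows the recursion of `D` clause by clause.
  coefficient : ∀ {n} → Subset n → Subset n → Carrier
  coefficient []          []          = 0#
  coefficient (true ∷ τ)  (true ∷ σ)  = - coefficient τ σ
  coefficient (true ∷ τ)  (false ∷ σ) = 0#
  coefficient (false ∷ τ) (true ∷ σ)  = if eqVec τ σ then 1# else 0#
  coefficient (false ∷ τ) (false ∷ σ) = coefficient τ σ

  sumOver-split : ∀ n (g : SetChain (suc n)) →
    sumOver (allSubsets (suc n)) g ≈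
    sumOver (allSubsets n) (g ∘ (true ∷_)) ⊕ sumOver (allSubsets n) (g ∘ (false ∷_))
  sumOver-split n g = F.trans (sumOver-++ (map (true ∷_) (allSubsets n)) _ g)
    (F.+-cong (sumOver-map _ (allSubsets n) g) (sumOver-map _ (allSubsets n) g))

  sumOver-eqVec : ∀ {n} (x : SetChain n) τ →
    sumOver (allSubsets n) (λ σ → x σ ⊛ (if eqVec τ σ then 1# else 0#)) ≈ x τ
  sumOver-eqVec x [] = F.trans (F.+-identityʳ _) (F.*-identityʳ _)
  sumOver-eqVec {suc n} x (true ∷ τ) = F.trans (sumOver-split n _)
    (F.trans (F.+-cong (sumOver-eqVec _ τ) (sumOver-zero (allSubsets n) λ _ → F.zeroʳ _)) (F.+-identityʳ _))
  sumOver-eqVec {suc n} x (false ∷ τ) = F.trans (sumOver-split n _)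
    (F.trans (F.+-cong (sumOver-zero (allSubsets n) λ _ → F.zeroʳ _) (sumOver-eqVec _ τ)) (F.+-identityˡ _))

  D-as-sum : ∀ {n} (x : SetChain n) τ →
    sumOver (allSubsets n) (λ σ → x σ ⊛ coefficient τ σ) ≈ D x τ
  D-as-sum x [] = F.trans (F.+-identityʳ _) (F.zeroʳ _)
  D-as-sum {suc n} x (true ∷ τ) = begin
    sumOver (allSubsets (suc n)) (λ σ → x σ ⊛ coefficient (true ∷ τ) σ)
      ≈⟨ sumOver-split n _ ⟩
    sumOver (allSubsets n) (λ σ → x (true ∷ σ) ⊛ (- coefficient τ σ)) ⊕
    sumOver (allSubsets n) (λ σ → x (false ∷ σ) ⊛ 0#)
      ≈⟨ F.+-cong (sumOver-cong (allSubsets n) λ _ → F.sym (FP.-‿distribʳ-* _ _))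
                  (sumOver-zero (allSubsets n) λ _ → F.zeroʳ _) ⟩
    sumOver (allSubsets n) (λ σ → - (x (true ∷ σ) ⊛ coefficient τ σ)) ⊕ 0#
      ≈⟨ F.+-identityʳ _ ⟩
    sumOver (allSubsets n) (λ σ → - (x (true ∷ σ) ⊛ coefficient τ σ))
      ≈⟨ sumOver-neg (allSubsets n) _ ⟩
    - sumOver (allSubsets n) (λ σ → x (true ∷ σ) ⊛ coefficient τ σ)
      ≈⟨ F.-‿cong (D-as-sum _ τ) ⟩
    - D (x ∘ (true ∷_)) τ ∎
  D-as-sum {suc n} x (false ∷ τ) = F.trans (sumOver-split n _)
    (F.+-cong (sumOver-eqVec _ τ) (D-as-sum _ τ))

-- From flags to dimensions, and from chains on subsets to chains on faces

module Comparison {c ℓ : Level} (K : Field c ℓ) {n : ℕ} (G : Graph n) where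
  open VectorSpace K
  open Operators K
  open Boundary-as-sum K
  open Neighbourhood G
  open Complex K G
  open Homology K G
  open Graph G using (adj)
  open Field K using (Carrier; _≈_; 0#; 1#; -_) renaming (_+_ to _⊕_; _*_ to _⊛_)
  open SetoidReasoning F.setoid

  sumF-cong : ∀ {m} {g h : Fin m → Carrier} → g ≋ h → sumF g ≈ sumF h
  sumF-cong {zero}  p = F.refl
  sumF-cong {suc m} p = F.+-cong (p zero) (sumF-cong (p ∘ suc))

  sumF-zero : ∀ {m} {g : Fin m → Carrier} → (g ≋ λ _ → 0#) → sumF g ≈ 0#
  sumF-zero {zero}  p = F.refl
  sumF-zero {suc m} p = F.trans (F.+-cong (p zero) (sumF-zero (p ∘ suc))) (F.+-identityˡ _)

  sumF-+ : ∀ {m} (g h : Fin m → Carrier) → sumF (λ s → g s ⊕ h s) ≈ sumF g ⊕ sumF h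
  sumF-+ {zero}  g h = F.sym (F.+-identityˡ _)
  sumF-+ {suc m} g h = F.trans (F.+-congˡ (sumF-+ (g ∘ suc) (h ∘ suc))) (interchange _ _ _ _)

  sumF-*ʳ : ∀ {m} (g : Fin m → Carrier) a → sumF (λ s → g s ⊛ a) ≈ sumF g ⊛ a
  sumF-*ʳ {zero}  g a = F.sym (F.zeroˡ a)
  sumF-*ʳ {suc m} g a = F.trans (F.+-congˡ (sumF-*ʳ (g ∘ suc) a)) (F.sym (F.distribʳ a _ _))

  sumF-punchIn : ∀ {m} t (g : Fin (suc m) → Carrier) → sumF g ≈ g t ⊕ sumF (g ∘ punchIn t)
  sumF-punchIn zero g = F.refl
  sumF-punchIn {suc m} (suc t) g = begin
    g zero ⊕ sumF (g ∘ suc)                                      ≈⟨ F.+-congˡ (sumF-punchIn t (g ∘ suc)) ⟩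
    g zero ⊕ (g (suc t) ⊕ sumF (g ∘ suc ∘ punchIn t))            ≈⟨ x∙yz≈y∙xz _ _ _ ⟩
    g (suc t) ⊕ (g zero ⊕ sumF (g ∘ suc ∘ punchIn t))            ∎

  cancel-≉0 : ∀ {a b} → ¬ b ≈ 0# → a ⊛ b ≈ 0# → a ≈ 0#
  cancel-≉0 {a} {b} b≉0 p = let b⁻¹ , q = Field.inverse K b b≉0 in begin
    a                ≈⟨ F.*-identityʳ a ⟨
    a ⊛ 1#           ≈⟨ F.*-congˡ q ⟨
    a ⊛ (b ⊛ b⁻¹)    ≈⟨ F.*-assoc _ _ _ ⟨
    (a ⊛ b) ⊛ b⁻¹    ≈⟨ F.*-congʳ p ⟩
    0# ⊛ b⁻¹         ≈⟨ F.zeroˡ _ ⟩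
    0#               ∎

  NotNotZero : ∀ {d} → Pred (Fin d)
  NotNotZero x = ∀ t → ¬ ¬ Lift c (x t ≈ 0#)

  -- Gaussian elimination in one row. If some entry is nonzero it serves as pivot; if none is, all
  -- entries are zero up to double negation and index zero with factors 0 will do.
  pivot : ∀ {m} (a : Fin (suc m) → Carrier) →
    ¬ ¬ ∃ λ t → Σ (Fin m → Carrier) λ l → ∀ s → a (punchIn t s) ⊕ l s ⊛ a t ≈ 0#
  pivot a k = ¬¬-excluded-middle {A = ∃ λ t → ¬ a t ≈ 0#} λ
    { (yes (t , a≉0)) → let a⁻¹ , q = Field.inverse K (a t) a≉0 in
        k (t , (λ s → - (a (punchIn t s) ⊛ a⁻¹)) , λ s → begin
          a (punchIn t s) ⊕ - (a (punchIn t s) ⊛ a⁻¹) ⊛ a t     ≈⟨ F.+-congˡ (FP.-‿distribˡ-* _ _) ⟨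
          a (punchIn t s) ⊕ - ((a (punchIn t s) ⊛ a⁻¹) ⊛ a t)   ≈⟨ F.+-congˡ (F.-‿cong (F.*-assoc _ _ _)) ⟩
          a (punchIn t s) ⊕ - (a (punchIn t s) ⊛ (a⁻¹ ⊛ a t))   ≈⟨ F.+-congˡ (F.-‿cong (F.*-congˡ (F.trans (F.*-comm _ _) q))) ⟩
          a (punchIn t s) ⊕ - (a (punchIn t s) ⊛ 1#)            ≈⟨ F.+-congˡ (F.-‿cong (F.*-identityʳ _)) ⟩
          a (punchIn t s) ⊕ - a (punchIn t s)                   ≈⟨ F.-‿inverseʳ _ ⟩
          0#                                                    ∎)
    ; (no none) → ¬¬-∀Fin (λ t a≉0 → none (t , a≉0)) λ z →
        k (zero , (λ _ → 0#) , λ s → comb-zero 0# (z (suc s)) (z zero)) }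

  eliminate-independent : ∀ {m d} (v : Fin (suc m) → Vect d) t (l : Fin m → Carrier) →
    LinIndep v → LinIndep (λ s → v (punchIn t s) +[ l s ] v t)
  eliminate-independent {m} v t l ind γ h s =
    subst (_≈ 0#) (insertAt-punchIn γ t a₀ s) (ind α h′ (punchIn t s))
    where
    -- This is the total weight of `v t` in the combination of the eliminated vectors, so inserting
    -- it at `t` turns a relation among those into one among the `v`.
    a₀ = sumF (λ s → γ s ⊛ l s)
    α = insertAt γ t a₀
    h′ : ∀ u → sumF (λ j → α j ⊛ v j u) ≈ 0#
    h′ u = begin
      sumF (λ j → α j ⊛ v j u)
        ≈⟨ sumF-punchIn t (λ j → α j ⊛ v j u) ⟩
      α t ⊛ v t u ⊕ sumF (λ s → α (punchIn t s) ⊛ v (punchIn t s) u)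
        ≈⟨ F.+-cong (F.*-congʳ (F.reflexive (insertAt-lookup γ t a₀)))
             (sumF-cong {m} λ s → F.*-congʳ (F.reflexive (insertAt-punchIn γ t a₀ s))) ⟩
      a₀ ⊛ v t u ⊕ sumF (λ s → γ s ⊛ v (punchIn t s) u)
        ≈⟨ F.+-congʳ (sumF-*ʳ (λ s → γ s ⊛ l s) (v t u)) ⟨
      sumF (λ s → (γ s ⊛ l s) ⊛ v t u) ⊕ sumF (λ s → γ s ⊛ v (punchIn t s) u)
        ≈⟨ sumF-+ (λ s → (γ s ⊛ l s) ⊛ v t u) (λ s → γ s ⊛ v (punchIn t s) u) ⟨
      sumF (λ s → (γ s ⊛ l s) ⊛ v t u ⊕ γ s ⊛ v (punchIn t s) u)
        ≈⟨ sumF-cong {m} (λ s → F.trans (F.+-comm _ _) (F.trans (F.+-congˡ (F.*-assoc _ _ _)) (F.sym (F.distribˡ (γ s) _ _)))) ⟩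
      sumF (λ s → γ s ⊛ (v (punchIn t s) u ⊕ l s ⊛ v t u))
        ≈⟨ h u ⟩
      0# ∎

  -- Each step of the flag costs one vector, spent on making its linear form vanish on the others.
  -- At the bottom some vector is left, and it is zero up to double negation, which is enough to
  -- refute independence.
  Dim≤⇒¬LinIndep : ∀ {d r m} {Z : Pred (Fin d)} → Dim≤ NotNotZero Z r → r < m →
    (v : Fin m → Vect d) → (∀ j → Z (v j)) → ¬ LinIndep v
  Dim≤⇒¬LinIndep {m = suc m} (included Z⊆0) r<m v v∈Z ind =
    ¬¬-∀Fin (Z⊆0 (v∈Z zero)) λ v₀≈0 →
      Field.0≉1 K (F.sym (ind δ (λ t → begin
        1# ⊛ v zero t ⊕ sumF (λ j → 0# ⊛ v (suc j) t)   ≈⟨ F.+-cong (F.*-identityˡ _) (sumF-zero {m} λ _ → F.zeroˡ _) ⟩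
        v zero t ⊕ 0#                                   ≈⟨ F.+-identityʳ _ ⟩
        v zero t                                        ≈⟨ lower (v₀≈0 t) ⟩
        0#                                              ∎) zero))
    where
    δ : Fin (suc m) → Carrier
    δ zero    = 1#
    δ (suc _) = 0#
  Dim≤⇒¬LinIndep {m = suc m} (extend φ lin tot ker dim) r<m v v∈Z ind =
    pivot (λ j → proj₁ (tot (v∈Z j))) λ (t , l , z) →
      Dim≤⇒¬LinIndep dim (s≤s⁻¹ r<m) (λ s → v (punchIn t s) +[ l s ] v t)
        (λ s → ker (lin (l s) (proj₂ (tot (v∈Z (punchIn t s)))) (proj₂ (tot (v∈Z t)))) (z s))
        (eliminate-independent v t l ind)

  -- Equality in K is neither decidable nor ¬¬-stable, so a maximal
  -- independent family is only found under ¬¬, and the flag ends at vectors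
  -- whose coordinates are only ¬¬-zero.
  independent-family : ∀ {d} (ts : List (Fin d)) (P : Pred (Fin d)) →
    (∀ {x y} a → P x → P y → P (x +[ a ] y)) →
    ¬ ¬ ∃ λ r → (Σ (Fin r → Vect d) λ w → LinIndep w × (∀ j → P (w j))) ×
      Dim≤ (λ x → P x × All (λ t → ¬ ¬ Lift c (x t ≈ 0#)) ts) P r
  independent-family [] P lin k =
    k (0 , ((λ ()) , (λ _ _ ()) , λ ()) , included λ p → p , [])
  independent-family {d} (t ∷ ts) P lin k =
    ¬¬-excluded-middle {A = ∃ λ u → P u × ¬ u t ≈ 0#} λ
    -- Here `u` is a pivot at `t`: the search continues among vectors vanishing at `t`, so `u` is
    -- independent of all later ones, and the coordinate `t` is the matching step of the flag.
    { (yes (u , u∈P , u≉0)) →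
        independent-family ts (λ x → P x × x t ≈ 0#)
          (λ a (p , p₀) (q , q₀) → lin a p q , comb-zero a p₀ q₀)
          λ (r , (w , ind , w∈P) , dim) → k (suc r ,
            (cons u w , cons-independent u≉0 w ind (proj₂ ∘ w∈P) , λ { zero → u∈P ; (suc j) → proj₁ (w∈P j) }) ,
            extend (λ x a → P x × x t ≈ a)
              (λ l (p , p₀) (q , q₀) → lin l p q , comb-cong l p₀ q₀)
              (λ {x} p → x t , p , F.refl)
              (λ (p , p₀) a≈0 → p , F.trans p₀ a≈0)
              (Dim≤-⊆ʳ (λ ((p , p₀) , z) → p , (λ k → k (lift p₀)) ∷ z) dim))
    ; (no none) →
        independent-family ts P lin λ (r , fam , dim) → k (r , fam ,
          Dim≤-⊆ʳ (λ {x} (p , z) → p , (λ x≉0 → none (x , p , x≉0 ∘ lift)) ∷ z) dim) }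
    where
    cons : ∀ {r} → Vect d → (Fin r → Vect d) → Fin (suc r) → Vect d
    cons u w zero    = u
    cons u w (suc j) = w j

    cons-independent : ∀ {r u} → ¬ u t ≈ 0# → (w : Fin r → Vect d) → LinIndep w →
      (∀ j → w j t ≈ 0#) → LinIndep (cons u w)
    cons-independent {u = u} u≉0 w ind w₀ a h = λ { zero → a₀≈0 ; (suc j) → ind (a ∘ suc) rest j }
      where
      a₀≈0 : a zero ≈ 0#
      a₀≈0 = cancel-≉0 u≉0 (begin
        a zero ⊛ u t                                         ≈⟨ F.+-identityʳ _ ⟨
        a zero ⊛ u t ⊕ 0#                                    ≈⟨ F.+-congˡ (sumF-zero λ j → F.trans (F.*-congˡ (w₀ j)) (F.zeroʳ _)) ⟨
        a zero ⊛ u t ⊕ sumF (λ j → a (suc j) ⊛ w j t)        ≈⟨ h t ⟩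
        0#                                                   ∎)
      rest : ∀ s → sumF (λ j → a (suc j) ⊛ w j s) ≈ 0#
      rest s = begin
        sumF (λ j → a (suc j) ⊛ w j s)                       ≈⟨ F.+-identityˡ _ ⟨
        0# ⊕ sumF (λ j → a (suc j) ⊛ w j s)                  ≈⟨ F.+-congʳ (F.trans (F.*-congʳ a₀≈0) (F.zeroˡ _)) ⟨
        a zero ⊛ u s ⊕ sumF (λ j → a (suc j) ⊛ w j s)        ≈⟨ h s ⟩
        0#                                                   ∎

  -- A maximal independent family in B has at most `b` members and continues the flag from B down to
  -- zero. With more than `r + b` independent vectors in Z, the joined flag would be too short.
  -- Decidability of `≤` discharges the double negations.
  IsDim-quotient : ∀ {d z b r} {Z B : Pred (Fin d)} →
    (∀ {x y} a → B x → B y → B (x +[ a ] y)) →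
    IsDim Z z → IsDim B b → Dim≤ B Z r → z ≤ r + b
  IsDim-quotient {d} {z} {b} {r} {Z} {B} B-comb ((v , ind , v∈Z) , _) (_ , B-max) dim =
    decidable-stable (z ≤? r + b) λ z≰ →
      independent-family (allFin d) B B-comb λ (s , (w , w-ind , w∈B) , dimB) →
        let s≤b = ≮⇒≥ λ b<s → B-max s b<s w w-ind w∈B
            dimZ = Dim≤-trans dim (Dim≤-⊆ʳ (λ (_ , zs) t → All.lookup zs (∈-allFin t)) dimB)
        in Dim≤⇒¬LinIndep dimZ (≤-<-trans (+-monoʳ-≤ r s≤b) (≰⇒> z≰)) v v∈Z ind

  full : VertexSet n
  full _ = true

  IsFace : ℕ → Subset n → Set
  IsFace k σ = T (independent G σ ∧ (card σ ≡ᵇ k))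

  IsFace⇒Face : ∀ {k σ} → IsFace k σ → Face full k σ
  IsFace⇒Face {k} {σ} h = let p , q = Equivalence.to (T-∧ {independent G σ}) h in record
    { within = λ _ _ → refl
    ; indep  = λ i j i∈σ j∈σ → nonadj i∈σ j∈σ
        (Equivalence.to T-not-≡ (allB⁻ (allB⁻ p (∈-allFin i)) (∈-allFin j)))
    ; size   = ≡ᵇ⇒≡ _ _ q }
    where
    nonadj : ∀ {a b e} → a ≡ true → b ≡ true → a ∧ b ∧ e ≡ false → e ≡ false
    nonadj refl refl p = p

  Face⇒IsFace : ∀ {k σ} → Face full k σ → IsFace k σ
  Face⇒IsFace {k} {σ} f = Equivalence.from (T-∧ {independent G σ})
    ( allB⁺ {xs = allFin n} (λ i → allB⁺ {xs = allFin n} λ j →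
        Equivalence.from T-not-≡ (nonadj (λ p q → Face.indep f i j p q)))
    , ≡⇒≡ᵇ _ _ (Face.size f))
    where
    nonadj : ∀ {a b e} → (a ≡ true → b ≡ true → e ≡ false) → a ∧ b ∧ e ≡ false
    nonadj {false} h = refl
    nonadj {true} {false} h = refl
    nonadj {true} {true} h = h refl refl

  IsFace? : ∀ k σ → Dec (IsFace k σ)
  IsFace? k σ = T? _

  face-IsFace : ∀ k s → IsFace k (face k s)
  face-IsFace k s = proj₂ (∈-filter⁻ (IsFace? k) {xs = allSubsets n} (∈-lookup s))

  faces-complete : ∀ k σ → IsFace k σ → σ ∈ faces G k
  faces-complete k σ h = ∈-filter⁺ (IsFace? k) (allSubsets-complete σ) h

  faces-unique : ∀ k → Unique (faces G k)
  faces-unique k = filter⁺ (IsFace? k) (allSubsets-unique n)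

  incidence≈coefficient : ∀ τ σ → incidence τ σ ≈ coefficient τ σ
  incidence≈coefficient τ σ = F.trans (F.reflexive (as-maybe τ σ)) (F.sym (coefficient-removed τ σ))
    where
    as-maybe : ∀ τ σ → incidence τ σ ≡ maybe′ sign 0# (removed τ σ)
    as-maybe τ σ with removed τ σ
    ... | just p  = refl
    ... | nothing = refl
    coefficient-removed : ∀ {m} (τ σ : Subset m) → coefficient τ σ ≈ maybe′ sign 0# (removed τ σ)
    coefficient-removed [] [] = F.refl
    coefficient-removed (true ∷ τ) (true ∷ σ) with removed τ σ | coefficient-removed τ σ
    ... | just p  | ih = F.-‿cong ih
    ... | nothing | ih = neg-zero ih
    coefficient-removed (true ∷ τ) (false ∷ σ) = F.refl
    coefficient-removed (false ∷ τ) (true ∷ σ) with eqVec τ σ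
    ... | true  = F.refl
    ... | false = F.refl
    coefficient-removed (false ∷ τ) (false ∷ σ) = coefficient-removed τ σ

  sumF-lookup : ∀ {A : Set} (xs : List A) (g : A → Carrier) → sumF (g ∘ List.lookup xs) ≈ sumOver xs g
  sumF-lookup []       g = F.refl
  sumF-lookup (x ∷ xs) g = F.+-congˡ (sumF-lookup xs g)

  Restricts : ∀ k → Chain k → SetChain n → Set (c ⊔ ℓ)
  Restricts k x X = Lift c (Supported full k X × x ≋ X ∘ face k)

  -- Since `X` vanishes off the faces, the sum over faces defining `∂` may be taken over all
  -- subsets.
  ∂≈D : ∀ k {x X} → Supported full (suc k) X → x ≋ X ∘ face (suc k) → ∂ k x ≋ D X ∘ face k
  ∂≈D k {x} {X} supp p t = begin
    sumF (λ s → x s ⊛ incidence τ (face (suc k) s))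
      ≈⟨ sumF-cong (λ s → F.*-cong (p s) (incidence≈coefficient τ (face (suc k) s))) ⟩
    sumF (λ s → X (face (suc k) s) ⊛ coefficient τ (face (suc k) s))
      ≈⟨ sumF-lookup (faces G (suc k)) (λ σ → X σ ⊛ coefficient τ σ) ⟩
    sumOver (faces G (suc k)) (λ σ → X σ ⊛ coefficient τ σ)
      ≈⟨ sumOver-filter (IsFace? (suc k)) (allSubsets n)
           (λ σ ¬f → F.trans (F.*-congʳ (supp σ (¬f ∘ Face⇒IsFace))) (F.zeroˡ _)) ⟩
    sumOver (allSubsets n) (λ σ → X σ ⊛ coefficient τ σ)
      ≈⟨ D-as-sum X τ ⟩
    D X τ ∎
    where τ = face k t

  extendByZero : ∀ k → Chain k → SetChain n
  extendByZero k x σ with IsFace? k σ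
  ... | yes f = x (index (faces-complete k σ f))
  ... | no _  = 0#

  extendByZero-restricts : ∀ k x → Restricts k x (extendByZero k x)
  extendByZero-restricts k x = lift (supp , agree)
    where
    supp : Supported full k (extendByZero k x)
    supp σ ¬f with IsFace? k σ
    ... | yes f = contradiction (IsFace⇒Face f) ¬f
    ... | no _  = F.refl
    agree : x ≋ extendByZero k x ∘ face k
    agree s with IsFace? k (face k s)
    ... | yes f = F.reflexive (cong x (lookup-injective (faces-unique k) s _
                    (lookup-index (faces-complete k (face k s) f))))
    ... | no ¬f = contradiction (face-IsFace k s) ¬f

  D-supported : ∀ {S k X} → Supported S (suc k) X → Supported S k (D X)
  D-supported {X = X} supp τ ¬f = D-zero X τ λ v v∉τ → supp _ (¬f ∘ Face-delete v τ v∉τ)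

  extendByZero-cycle : ∀ k x → Cycle k x → IsCycle full k (extendByZero k x)
  extendByZero-cycle k x z with extendByZero-restricts k x
  ... | lift (supp , agree) = record { supported = supp ; closed = closed k x z supp agree }
    where
    closed : ∀ k x → Cycle k x → Supported full k (extendByZero k x) → x ≋ extendByZero k x ∘ face k →
      D (extendByZero k x) ≋ λ _ → 0#
    -- `Cycle` imposes nothing at index 0, so closedness comes from size: `D` reads its argument
    -- only at nonempty sets.
    closed zero x z supp agree τ = D-zero _ τ λ v v∉τ → supp _ λ f →
      contradiction (trans (sym (card-insert v τ v∉τ)) (Face.size f)) λ ()
    closed (suc k) x z supp agree τ with IsFace? k τ
    -- Off the faces `D` vanishes because subsets of faces are faces; on a face its value is an
    -- entry of `∂`.
    ... | no ¬f = D-supported supp τ (¬f ∘ Face⇒IsFace)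
    ... | yes f = let p = lookup-index (faces-complete k τ f) in begin
      D X τ                        ≈⟨ F.reflexive (cong (D X) p) ⟩
      D X (face k _)               ≈⟨ ∂≈D k supp agree _ ⟨
      ∂ k x _                      ≈⟨ lower z _ ⟩
      0#                           ∎
      where X = extendByZero (suc k) x

  Restricts-boundary : ∀ {k x X} → Restricts k x X → IsBoundary full k X → Boundary k x
  Restricts-boundary {k} (lift (_ , p)) (W , supp , q) =
    W ∘ face (suc k) , λ t → F.trans (∂≈D k supp (λ _ → F.refl) t)
      (F.trans (q (face k t)) (F.sym (p t)))

  Boundary-comb : ∀ {k x y} a → Boundary k x → Boundary k y → Boundary k (x +[ a ] y)
  Boundary-comb {k} a (w , p) (w′ , q) = w +[ a ] w′ , λ t → begin
    sumF (λ s → (w s ⊕ a ⊛ w′ s) ⊛ inc t s)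
      ≈⟨ sumF-cong {f (suc k)} (λ s → F.trans (F.distribʳ (inc t s) _ _) (F.+-congˡ (F.trans (F.*-assoc _ _ _) (F.*-comm _ _)))) ⟩
    sumF (λ s → w s ⊛ inc t s ⊕ (w′ s ⊛ inc t s) ⊛ a)
      ≈⟨ sumF-+ (λ s → w s ⊛ inc t s) (λ s → (w′ s ⊛ inc t s) ⊛ a) ⟩
    ∂ k w t ⊕ sumF (λ s → (w′ s ⊛ inc t s) ⊛ a)
      ≈⟨ F.+-cong (p t) (F.trans (sumF-*ʳ (λ s → w′ s ⊛ inc t s) a) (F.trans (F.*-congʳ (q t)) (F.*-comm _ _))) ⟩
    _ ∎
    where inc = λ t s → incidence (face k t) (face (suc k) s)

  HomDim≤ : ∀ {k h r} → HomologyDim≤ full k r → HomDim k h → h ≤ r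
  HomDim≤ {k} {h} {r} dim (z , b , dimZ , dimB , h+b≡z) =
    +-cancelʳ-≤ b h r (subst (_≤ r + b) (sym h+b≡z)
      (IsDim-quotient (Boundary-comb {k}) dimZ dimB (Dim≤-pullback (Restricts k)
        (λ a (lift (s , p)) (lift (s′ , q)) → lift (Supported-comb a s s′ , λ t → comb-cong a (p t) (q t)))
        (λ {x} c → extendByZero k x , extendByZero-restricts k x , extendByZero-cycle k x c)
        Restricts-boundary dim)))

-- Arithmetic of the branching: admissible growth rates

-- Q s b: the bound b is admissible for s vertices.  R s d e b: b is
-- admissible for the e last branches when the d neighbours of a vertex are
-- deleted one after another.  Gap s d e s′: a branch followed by e others
-- may have s′ vertices.
record Growth (Q : ℕ → ℕ → Set) (Gap : ℕ → ℕ → ℕ → ℕ → Set) : Set₁ where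
  field
    R        : ℕ → ℕ → ℕ → ℕ → Set
    base     : Q 0 1
    R-nil    : ∀ s d → R s d 0 0
    R-cons   : ∀ s d e s′ b b′ → Gap s d e s′ → Q s′ b′ → R s d e b → R s d (suc e) (b′ + b)
    R-finish : ∀ s d b → R s d d b → Q s b

-- This is d ≤ Θ^(d+1), with equality at d = 4; that case dictates the value of Θ.
d^5≤4^[1+d] : ∀ d → d ^ 5 ≤ 4 ^ suc d
d^5≤4^[1+d] 0 = z≤n
d^5≤4^[1+d] 1 = m≤m+n 1 15
d^5≤4^[1+d] 2 = m≤m+n 32 32
d^5≤4^[1+d] 3 = m≤m+n 243 13
-- The induction needs (d+1)⁵ ≤ 4d⁵, which fails at d = 3 (1024 against 972), so it starts at 4.
d^5≤4^[1+d] (suc (suc (suc (suc k)))) = large k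
  where
  open ≤-Reasoning
  large : ∀ k → (4 + k) ^ 5 ≤ 4 ^ (5 + k)
  large zero = ≤-refl
  large (suc k) = begin
    (5 + k) ^ 5                    ≤⟨ m≤m+n _ _ ⟩
    -- The bracket is the expansion of 4(4+k)⁵ - (5+k)⁵, which has no negative coefficient.
    (5 + k) ^ 5 + (3 * k ^ 5 + 55 * k ^ 4 + 390 * k ^ 3 + 1310 * k ^ 2 + 1995 * k + 971)
                                   ≡⟨ expand k ⟩
    4 * (4 + k) ^ 5                ≤⟨ *-monoʳ-≤ 4 (large k) ⟩
    4 * 4 ^ (5 + k)                ∎
    where
    expand : ∀ k → (5 + k) ^ 5 + (3 * k ^ 5 + 55 * k ^ 4 + 390 * k ^ 3 + 1310 * k ^ 2 + 1995 * k + 971)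
      ≡ 4 * (4 + k) ^ 5
    expand = solve 1 (λ k →
      (con 5 :+ k) :^ 5 :+ (con 3 :* k :^ 5 :+ con 55 :* k :^ 4 :+ con 390 :* k :^ 3 :+ con 1310 :* k :^ 2 :+ con 1995 :* k :+ con 971) :=
      con 4 :* (con 4 :+ k) :^ 5) refl

general-growth : Growth (λ s b → b ^ 5 ≤ 4 ^ s) (λ s d e s′ → s′ + suc d ≤ s)
general-growth = record
  { R        = R
  ; base     = ≤-refl
  ; R-nil    = λ s d → 0 , z≤n , z≤n
  ; R-cons   = cons
  ; R-finish = finish
  }
  where
  open ≤-Reasoning
  -- `M` is at most Θ^(s-d-1) and is a common bound for the `e` branches; the exponent is moved
  -- across to avoid subtraction.
  R : ℕ → ℕ → ℕ → ℕ → Set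
  R s d e b = ∃ λ M → M ^ 5 * 4 ^ suc d ≤ 4 ^ s × b ≤ e * M

  cons : ∀ s d e s′ b b′ → s′ + suc d ≤ s → b′ ^ 5 ≤ 4 ^ s′ → R s d e b → R s d (suc e) (b′ + b)
  cons s d e s′ b b′ gap q (M , p , b≤) =
    b′ ⊔ℕ M , max , +-mono-≤ (m≤m⊔n b′ M) (≤-trans b≤ (*-monoʳ-≤ e (m≤n⊔m b′ M)))
    where
    new : b′ ^ 5 * 4 ^ suc d ≤ 4 ^ s
    new = begin
      b′ ^ 5 * 4 ^ suc d   ≤⟨ *-monoˡ-≤ (4 ^ suc d) q ⟩
      4 ^ s′ * 4 ^ suc d   ≡⟨ ^-distribˡ-+-* 4 s′ (suc d) ⟨
      4 ^ (s′ + suc d)     ≤⟨ ^-monoʳ-≤ 4 gap ⟩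
      4 ^ s                ∎
    max : (b′ ⊔ℕ M) ^ 5 * 4 ^ suc d ≤ 4 ^ s
    max with ⊔-sel b′ M
    ... | inj₁ eq rewrite eq = new
    ... | inj₂ eq rewrite eq = p

  finish : ∀ s d b → R s d d b → b ^ 5 ≤ 4 ^ s
  finish s d b (M , p , b≤) = begin
    b ^ 5                ≤⟨ ^-monoˡ-≤ 5 b≤ ⟩
    (d * M) ^ 5          ≡⟨ power d M ⟩
    M ^ 5 * d ^ 5        ≤⟨ *-monoʳ-≤ (M ^ 5) (d^5≤4^[1+d] d) ⟩
    M ^ 5 * 4 ^ suc d    ≤⟨ p ⟩
    4 ^ s                ∎
    where
    power : ∀ d M → (d * M) ^ 5 ≡ M ^ 5 * d ^ 5
    power = solve 2 (λ d M →
      (d :* M) :^ 5 :=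
      M :^ 5 :* d :^ 5) refl

-- The triangle-free rate: rationals p/q above Γ

module TriangleFreeGrowth (p q : ℕ) (0<q : 0 < q)
  (h : q ^ 6 + p * q ^ 5 + p ^ 2 * q ^ 4 < p ^ 6) where
  open ≤-Reasoning

  private instance
    q≢0 : NonZero q
    q≢0 = >-nonZero 0<q

  q≤p : q ≤ p
  q≤p with q ≤? p
  ... | yes q≤p = q≤p
  ... | no q≰p = contradiction (≤-trans (^-monoˡ-≤ 6 (<⇒≤ (≰⇒> q≰p)))
          (≤-trans (m≤m+n (q ^ 6) (p * q ^ 5)) (m≤m+n _ (p ^ 2 * q ^ 4)))) (<⇒≱ h)

  private instance
    p≢0 : NonZero p
    p≢0 = >-nonZero (≤-trans 0<q q≤p)

  -- The homogeneous form of 1 + y + ... + y^(e-1) at y = q/p.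
  geometric : ℕ → ℕ
  geometric zero    = 0
  geometric (suc e) = p ^ e + q * geometric e

  -- With y = q/p: y⁶ + y⁵ + y⁴ − 1 = (1 + y²)(y⁴ + y³ − 1) + y²(1 − y).
  two-branches : q ^ 4 + p * q ^ 3 ≤ p ^ 4
  two-branches with m≤n⇒∃[o]m+o≡n q≤p
  ... | r , refl = <⇒≤ (*-cancelˡ-< (p ^ 2 + q ^ 2) _ _ (+-cancelˡ-< (p ^ 6) _ _ (begin-strict
      p ^ 6 + (p ^ 2 + q ^ 2) * (q ^ 4 + p * q ^ 3)                         ≤⟨ m≤m+n _ (p ^ 3 * q ^ 2 * r) ⟩
      p ^ 6 + (p ^ 2 + q ^ 2) * (q ^ 4 + p * q ^ 3) + p ^ 3 * q ^ 2 * r     ≡⟨ identity q r ⟩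
      q ^ 6 + p * q ^ 5 + p ^ 2 * q ^ 4 + (p ^ 2 + q ^ 2) * p ^ 4           <⟨ +-monoˡ-< _ h ⟩
      p ^ 6 + (p ^ 2 + q ^ 2) * p ^ 4                                       ∎)))
    where
    identity : ∀ q r → let p = q + r in
      p ^ 6 + (p ^ 2 + q ^ 2) * (q ^ 4 + p * q ^ 3) + p ^ 3 * q ^ 2 * r
      ≡ q ^ 6 + p * q ^ 5 + p ^ 2 * q ^ 4 + (p ^ 2 + q ^ 2) * p ^ 4
    identity = solve 2 (λ q r →
      (q :+ r) :^ 6 :+ ((q :+ r) :^ 2 :+ q :^ 2) :* (q :^ 4 :+ (q :+ r) :* q :^ 3) :+ (q :+ r) :^ 3 :* q :^ 2 :* r :=
      q :^ 6 :+ (q :+ r) :* q :^ 5 :+ (q :+ r) :^ 2 :* q :^ 4 :+ ((q :+ r) :^ 2 :+ q :^ 2) :* (q :+ r) :^ 4) refl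

  -- With y = q/p: y⁶ + y⁵ + y⁴ − 1 = (1 + y)(y⁵ + y² − 1) + y(1 + y)(1 − y)².
  decay₃ : q ^ 5 + q ^ 2 * p ^ 3 ≤ p ^ 5
  decay₃ with m≤n⇒∃[o]m+o≡n q≤p
  ... | r , refl = <⇒≤ (*-cancelˡ-< (p + q) _ _ (+-cancelˡ-< (p ^ 6) _ _ (begin-strict
      p ^ 6 + (p + q) * (q ^ 5 + q ^ 2 * p ^ 3)                                      ≤⟨ m≤m+n _ (p ^ 2 * q * (p + q) * r ^ 2) ⟩
      p ^ 6 + (p + q) * (q ^ 5 + q ^ 2 * p ^ 3) + p ^ 2 * q * (p + q) * r ^ 2        ≡⟨ identity q r ⟩
      q ^ 6 + p * q ^ 5 + p ^ 2 * q ^ 4 + (p + q) * p ^ 5                            <⟨ +-monoˡ-< _ h ⟩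
      p ^ 6 + (p + q) * p ^ 5                                                        ∎)))
    where
    identity : ∀ q r → let p = q + r in
      p ^ 6 + (p + q) * (q ^ 5 + q ^ 2 * p ^ 3) + p ^ 2 * q * (p + q) * r ^ 2
      ≡ q ^ 6 + p * q ^ 5 + p ^ 2 * q ^ 4 + (p + q) * p ^ 5
    identity = solve 2 (λ q r →
      (q :+ r) :^ 6 :+ ((q :+ r) :+ q) :* (q :^ 5 :+ q :^ 2 :* (q :+ r) :^ 3) :+ (q :+ r) :^ 2 :* q :* ((q :+ r) :+ q) :* r :^ 2 :=
      q :^ 6 :+ (q :+ r) :* q :^ 5 :+ (q :+ r) :^ 2 :* q :^ 4 :+ ((q :+ r) :+ q) :* (q :+ r) :^ 5) refl

  -- In terms of y = q/p this is y^(5+k) + y² ≤ 1, which only gets easier as k grows because y ≤ 1.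
  decay : ∀ k → q ^ (5 + k) + q ^ 2 * p ^ (3 + k) ≤ p ^ (5 + k)
  decay zero    = decay₃
  decay (suc k) = begin
    q * q ^ (5 + k) + q ^ 2 * (p * p ^ (3 + k))   ≤⟨ +-monoˡ-≤ _ (*-monoˡ-≤ (q ^ (5 + k)) q≤p) ⟩
    p * q ^ (5 + k) + q ^ 2 * (p * p ^ (3 + k))   ≡⟨ factor p (q ^ (5 + k)) (q ^ 2) (p ^ (3 + k)) ⟩
    p * (q ^ (5 + k) + q ^ 2 * p ^ (3 + k))       ≤⟨ *-monoʳ-≤ p (decay k) ⟩
    p * p ^ (5 + k)                               ∎
    where
    factor : ∀ p a b c → p * a + b * (p * c) ≡ p * (a + b * c)
    factor = solve-∀

  branches : ∀ d → q ^ suc d * geometric d ≤ p ^ (d + d)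
  branches 0 = ≤-trans (≤-reflexive (*-zeroʳ (q ^ 1))) z≤n
  branches 1 = ≤-trans (≤-reflexive (simp q)) (^-monoˡ-≤ 2 q≤p)
    where
    simp : ∀ q → q ^ 2 * (1 + q * 0) ≡ q ^ 2
    simp = solve 1 (λ q →
      q :^ 2 :* (con 1 :+ q :* con 0) :=
      q :^ 2) refl
  branches 2 = ≤-trans (≤-reflexive (simp p q)) two-branches
    where
    simp : ∀ p q → q ^ 3 * (p ^ 1 + q * (1 + q * 0)) ≡ q ^ 4 + p * q ^ 3
    simp = solve 2 (λ p q →
      q :^ 3 :* (p :^ 1 :+ q :* (con 1 :+ q :* con 0)) :=
      q :^ 4 :+ p :* q :^ 3) refl
  branches (suc (suc (suc k))) = many k
    where
    many : ∀ k → q ^ (4 + k) * geometric (3 + k) ≤ p ^ ((3 + k) + (3 + k))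
    many zero = ≤-trans (≤-reflexive (simp p q)) (<⇒≤ h)
      where
      simp : ∀ p q → q ^ 4 * (p ^ 2 + q * (p ^ 1 + q * (1 + q * 0))) ≡ q ^ 6 + p * q ^ 5 + p ^ 2 * q ^ 4
      simp = solve 2 (λ p q →
        q :^ 4 :* (p :^ 2 :+ q :* (p :^ 1 :+ q :* (con 1 :+ q :* con 0))) :=
        q :^ 6 :+ p :* q :^ 5 :+ p :^ 2 :* q :^ 4) refl
    many (suc k) = begin
      q * q ^ (4 + k) * (P + q * geometric (3 + k))           ≡⟨ expand q (q ^ (4 + k)) P (geometric (3 + k)) ⟩
      q * q ^ (4 + k) * P + q ^ 2 * (q ^ (4 + k) * geometric (3 + k))
                                                              ≤⟨ +-monoʳ-≤ _ (*-monoʳ-≤ (q ^ 2) (many k)) ⟩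
      q * q ^ (4 + k) * P + q ^ 2 * p ^ ((3 + k) + (3 + k))   ≡⟨ cong (λ z → q * q ^ (4 + k) * P + q ^ 2 * z) (^-distribˡ-+-* p (3 + k) (3 + k)) ⟩
      q ^ (5 + k) * P + q ^ 2 * (P * P)                       ≡⟨ factor (q ^ (5 + k)) (q ^ 2) P ⟩
      (q ^ (5 + k) + q ^ 2 * P) * P                           ≤⟨ *-monoˡ-≤ P (decay k) ⟩
      p ^ (5 + k) * P                                         ≡⟨ ^-distribˡ-+-* p (5 + k) (3 + k) ⟨
      p ^ ((5 + k) + (3 + k))                                 ≡⟨ cong (p ^_) (cong (4 +_) (sym (+-suc k (3 + k)))) ⟩
      p ^ ((4 + k) + (4 + k))                                 ∎
      where
      P = p ^ (3 + k)
      expand : ∀ q a b g → q * a * (b + q * g) ≡ q * a * b + q ^ 2 * (a * g)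
      expand = solve 4 (λ q a b g →
        q :* a :* (b :+ q :* g) :=
        q :* a :* b :+ q :^ 2 :* (a :* g)) refl
      factor : ∀ a b c → a * c + b * (c * c) ≡ (a + b * c) * c
      factor = solve-∀

  triangle-free-growth : Growth (λ s b → b * q ^ s ≤ p ^ s) (λ s d e s′ → s′ + (d + d) ≤ s + e)
  triangle-free-growth = record
    { R        = R
    ; base     = ≤-refl
    ; R-nil    = λ s d → z≤n
    ; R-cons   = cons
    ; R-finish = finish
    }
    where
    -- Cleared of denominators, with x = p/q: b is at most the sum of x^(s-2d+j) over j < e, where s
    -- - 2d + j bounds the vertices of the branch followed by j others.
    R : ℕ → ℕ → ℕ → ℕ → Set
    R s d e b = b * (q ^ s * p ^ (d + d) * q ^ e) ≤ p ^ s * q ^ (d + d) * (q * geometric e)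

    cons : ∀ s d e s′ b b′ → s′ + (d + d) ≤ s + e → b′ * q ^ s′ ≤ p ^ s′ →
      R s d e b → R s d (suc e) (b′ + b)
    cons s d e s′ b b′ gap bound r with m≤n⇒∃[o]m+o≡n gap
    -- `t` is the slack in the gap, for a branch smaller than allowed; q ^ t ≤ p ^ t absorbs it.
    ... | t , eq = begin
      (b′ + b) * (q ^ s * P * (q * q ^ e))                            ≡⟨ split b′ b (q ^ s) P q (q ^ e) ⟩
      q * (b′ * (q ^ s * q ^ e) * P) + q * (b * (q ^ s * P * q ^ e))  ≤⟨ +-mono-≤ (*-monoʳ-≤ q new) (*-monoʳ-≤ q r) ⟩
      q * (Q * (p ^ s * p ^ e)) + q * (p ^ s * Q * (q * geometric e)) ≡⟨ join q Q (p ^ s) (p ^ e) (geometric e) ⟩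
      p ^ s * Q * (q * (p ^ e + q * geometric e))                     ∎
      where
      P = p ^ (d + d)
      Q = q ^ (d + d)
      split : ∀ b′ b a P q c → (b′ + b) * (a * P * (q * c)) ≡ q * (b′ * (a * c) * P) + q * (b * (a * P * c))
      split = solve-∀
      join : ∀ q Q a c g → q * (Q * (a * c)) + q * (a * Q * (q * g)) ≡ a * Q * (q * (c + q * g))
      join = solve-∀
      decompose : ∀ x → x ^ s * x ^ e ≡ x ^ s′ * x ^ (d + d) * x ^ t
      decompose x = begin-equality
        x ^ s * x ^ e                   ≡⟨ ^-distribˡ-+-* x s e ⟨
        x ^ (s + e)                     ≡⟨ cong (x ^_) eq ⟨
        x ^ (s′ + (d + d) + t)          ≡⟨ ^-distribˡ-+-* x (s′ + (d + d)) t ⟩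
        x ^ (s′ + (d + d)) * x ^ t      ≡⟨ cong (_* x ^ t) (^-distribˡ-+-* x s′ (d + d)) ⟩
        x ^ s′ * x ^ (d + d) * x ^ t    ∎
      new : b′ * (q ^ s * q ^ e) * P ≤ Q * (p ^ s * p ^ e)
      new = begin
        b′ * (q ^ s * q ^ e) * P          ≡⟨ cong (λ z → b′ * z * P) (decompose q) ⟩
        b′ * (q ^ s′ * Q * q ^ t) * P     ≡⟨ pull b′ (q ^ s′) Q (q ^ t) P ⟩
        (b′ * q ^ s′) * q ^ t * (Q * P)   ≤⟨ *-monoˡ-≤ (Q * P) (*-mono-≤ bound (^-monoˡ-≤ t q≤p)) ⟩
        p ^ s′ * p ^ t * (Q * P)          ≡⟨ push (p ^ s′) (p ^ t) Q P ⟩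
        Q * (p ^ s′ * P * p ^ t)          ≡⟨ cong (Q *_) (decompose p) ⟨
        Q * (p ^ s * p ^ e)               ∎
        where
        pull : ∀ b a Q t P → b * (a * Q * t) * P ≡ (b * a) * t * (Q * P)
        pull = solve-∀
        push : ∀ a t Q P → a * t * (Q * P) ≡ Q * (a * P * t)
        push = solve-∀

    finish : ∀ s d b → R s d d b → b * q ^ s ≤ p ^ s
    finish s d b r = *-cancelʳ-≤ (b * q ^ s) (p ^ s) (p ^ (d + d) * q ^ d) (begin
      b * q ^ s * (p ^ (d + d) * q ^ d)                ≡⟨ assoc b (q ^ s) (p ^ (d + d)) (q ^ d) ⟩
      b * (q ^ s * p ^ (d + d) * q ^ d)                ≤⟨ r ⟩
      p ^ s * q ^ (d + d) * (q * geometric d)          ≡⟨ cong (λ z → p ^ s * z * (q * geometric d)) (^-distribˡ-+-* q d d) ⟩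
      p ^ s * (q ^ d * q ^ d) * (q * geometric d)      ≡⟨ regroup (p ^ s) (q ^ d) q (geometric d) ⟩
      p ^ s * (q ^ suc d * geometric d * q ^ d)        ≤⟨ *-monoʳ-≤ (p ^ s) (*-monoˡ-≤ (q ^ d) (branches d)) ⟩
      p ^ s * (p ^ (d + d) * q ^ d)                    ∎)
      where
      instance
        nz : NonZero (p ^ (d + d) * q ^ d)
        nz = m*n≢0 _ _ {{m^n≢0 p (d + d)}} {{m^n≢0 q d}}
      assoc : ∀ b a P c → b * a * (P * c) ≡ b * (a * P * c)
      assoc = solve-∀
      regroup : ∀ a c q g → a * (c * c) * (q * g) ≡ a * (q * c * g * c)
      regroup = solve-∀

-- Counting vertices, and sums over degrees of homology

count : ∀ {n} → VertexSet n → ℕ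
count {zero}  S = 0
count {suc n} S = indicator (S zero) + count (S ∘ suc)
  where
  indicator : Bool → ℕ
  indicator true  = 1
  indicator false = 0

count-mono : ∀ {n} {S T : VertexSet n} → (∀ i → S i ≡ true → T i ≡ true) → count S ≤ count T
count-mono {zero}  h = z≤n
count-mono {suc n} {S} {T} h with S zero | T zero | h zero
... | true  | true  | _ = s≤s (count-mono (h ∘ suc))
... | true  | false | z = contradiction (z refl) λ ()
... | false | true  | _ = m≤n⇒m≤1+n (count-mono (h ∘ suc))
... | false | false | _ = count-mono (h ∘ suc)

count-cong : ∀ {n} {S T : VertexSet n} → (∀ i → S i ≡ T i) → count S ≡ count T
count-cong h = ≤-antisym (count-mono λ i p → trans (sym (h i)) p) (count-mono λ i p → trans (h i) p)

count-empty : ∀ {n} {S : VertexSet n} → (∀ i → S i ≡ false) → count S ≡ 0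
count-empty {zero}  h = refl
count-empty {suc n} h rewrite h zero = count-empty (h ∘ suc)

count-full : ∀ n → count {n} (λ _ → true) ≡ n
count-full zero    = refl
count-full (suc n) = cong suc (count-full n)

count≡0⇒empty : ∀ {n} {S : VertexSet n} → count S ≡ 0 → ∀ i → S i ≡ false
count≡0⇒empty {suc n} {S} p i with S zero in eq
count≡0⇒empty {suc n} {S} p zero    | false = eq
count≡0⇒empty {suc n} {S} p (suc i) | false = count≡0⇒empty p i

member : ∀ {n k} (S : VertexSet n) → count S ≡ suc k → ∃ λ i → S i ≡ true
member S p with any? (λ i → S i Bool.≟ true)
... | yes q = q
... | no q  = contradiction (trans (sym p) (count-empty λ i → ¬-not λ z → q (i , z))) λ ()

count-partition : ∀ {n} (S T : VertexSet n) →
  count S ≡ count (λ i → S i ∧ not (T i)) + count (λ i → S i ∧ T i)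
count-partition {zero}  S T = refl
count-partition {suc n} S T with S zero | T zero
... | true  | false = cong suc (count-partition (S ∘ suc) (T ∘ suc))
... | false | _     = count-partition (S ∘ suc) (T ∘ suc)
... | true  | true  = trans (cong suc (count-partition (S ∘ suc) (T ∘ suc))) (sym (+-suc _ _))

count-∖ : ∀ {n} (S : VertexSet n) v → S v ≡ true → count S ≡ suc (count (S ∖ v))
count-∖ {suc n} S zero    p with S zero
... | true = cong suc (count-cong λ i → sym (∖-suc i))
  where
  ∖-suc : ∀ i → S (suc i) ∧ true ≡ S (suc i)
  ∖-suc i with S (suc i)
  ... | true  = refl
  ... | false = refl
count-∖ {suc n} S (suc v) p with S zero
... | true  = cong suc (count-∖ (S ∘ suc) v p)
... | false = count-∖ (S ∘ suc) v p

sumBelow : (ℕ → ℕ) → ℕ → ℕ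
sumBelow g zero    = 0
sumBelow g (suc N) = g 0 + sumBelow (g ∘ suc) N

sumBelow-+ : ∀ g h N → sumBelow (λ k → g k + h k) N ≡ sumBelow g N + sumBelow h N
sumBelow-+ g h zero    = refl
sumBelow-+ g h (suc N) = trans (cong (g 0 + h 0 +_) (sumBelow-+ (g ∘ suc) (h ∘ suc) N))
  (swap (g 0) (h 0) (sumBelow (g ∘ suc) N) (sumBelow (h ∘ suc) N))
  where
  swap : ∀ a b c d → a + b + (c + d) ≡ a + c + (b + d)
  swap = solve-∀

sumBelow-zero : ∀ N → sumBelow (λ _ → 0) N ≡ 0
sumBelow-zero zero    = refl
sumBelow-zero (suc N) = sumBelow-zero N

-- Homology of a link contributes one degree higher, and nothing at index 0.
shift : (ℕ → ℕ) → ℕ → ℕ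
shift g zero    = 0
shift g (suc k) = g k

-- Vertex degrees and the sizes of branches

module Degree {n : ℕ} (G : Graph n) where
  open Graph G using (adj)
  open Neighbourhood G

  degree : VertexSet n → Fin n → ℕ
  degree S v = count (λ i → S i ∧ adj v i)

  self-nonadjacent : ∀ S v → S v ≡ true → nonadjacent S v v ≡ true
  self-nonadjacent S v v∈S rewrite v∈S | Graph.irrefl G v = refl

  adjacent⇒≢ : ∀ {u v} → adj v u ≡ true → v ≢ u
  adjacent⇒≢ {u} p refl = contradiction (trans (sym p) (Graph.irrefl G u)) λ ()

  count-∖N : ∀ S v → S v ≡ true → count S ≡ suc (count (S ∖N[ v ])) + degree S v
  count-∖N S v v∈S = trans (count-partition S (adj v))
    (cong (_+ degree S v) (count-∖ (nonadjacent S v) v (self-nonadjacent S v v∈S)))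

  degree-∖ : ∀ S v u → S u ≡ true → adj v u ≡ true → degree S v ≡ suc (degree (S ∖ u) v)
  degree-∖ S v u u∈S vu = trans (count-∖ (λ i → S i ∧ adj v i) u u∈) (cong suc (count-cong swap))
    where
    u∈ : S u ∧ adj v u ≡ true
    u∈ rewrite u∈S = vu
    swap : ∀ i → (S i ∧ adj v i) ∧ not (does (i ≟ u)) ≡ (S i ∧ not (does (i ≟ u))) ∧ adj v i
    swap i with S i | adj v i
    ... | false | _     = refl
    ... | true  | true  with does (i ≟ u)
    ...   | true  = refl
    ...   | false = refl
    swap i | true | false with does (i ≟ u)
    ...   | true  = refl
    ...   | false = refl

  MinDegree : VertexSet n → Fin n → Set
  MinDegree S v = ∀ u → S u ≡ true → degree S v ≤ degree S u

  min-degree-vertex : ∀ S v → S v ≡ true → ∃ λ w → S w ≡ true × MinDegree S w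
  min-degree-vertex S v v∈S = search (degree S v) v v∈S ≤-refl
    where
    search : ∀ m v → S v ≡ true → degree S v ≤ m → ∃ λ w → S w ≡ true × MinDegree S w
    search m v v∈S d≤m with any? (λ u → (S u Bool.≟ true) ×-dec (degree S u <? degree S v))
    ... | no none = v , v∈S , λ u u∈S → ≮⇒≥ λ d<d → none (u , u∈S , d<d)
    search zero    v v∈S d≤m | yes (u , u∈S , d<d) = contradiction (<-≤-trans d<d d≤m) λ ()
    search (suc m) v v∈S d≤m | yes (u , u∈S , d<d) = search m u u∈S (s≤s⁻¹ (≤-trans d<d d≤m))

  -- S′ arises from S by deleting some neighbours of v; e of them remain.
  record Stage (S S′ : VertexSet n) (v : Fin n) (e : ℕ) : Set where
    field
      minimal : MinDegree S v
      subset  : ∀ i → S′ i ≡ true → S i ≡ true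
      centre  : S′ v ≡ true
      left    : degree S′ v ≡ e
      size    : count S′ + degree S v ≡ count S + e
      deleted : ∀ i → S i ≡ true → S′ i ≡ false → adj v i ≡ true
  open Stage

  initial : ∀ {S v} → S v ≡ true → MinDegree S v → Stage S S v (degree S v)
  initial v∈S m = record
    { minimal = m ; subset = λ _ p → p ; centre = v∈S ; left = refl ; size = refl
    ; deleted = λ i p q → contradiction (trans (sym p) q) λ () }

  next : ∀ {S S′ v e u} → Stage S S′ v (suc e) → S′ u ≡ true → adj v u ≡ true → Stage S (S′ ∖ u) v e
  next {S} {S′} {v} {e} {u} st u∈S′ vu = record
    { minimal = minimal st
    ; subset  = λ i p → subset st i (proj₁ (∖⁻ S′ u i p))
    ; centre  = ∖⁺ S′ u v (centre st) (adjacent⇒≢ vu)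
    ; left    = suc-injective (trans (sym (degree-∖ S′ v u u∈S′ vu)) (left st))
    ; size    = suc-injective (trans (cong (_+ degree S v) (sym (count-∖ S′ u u∈S′)))
                  (trans (size st) (+-suc _ _)))
    ; deleted = del }
    where
    del : ∀ i → S i ≡ true → (S′ ∖ u) i ≡ false → adj v i ≡ true
    del i p q with S′ i in eq
    ... | false = deleted st i p eq
    ... | true with i ≟ u
    ...   | yes refl = vu
    ...   | no _ = contradiction q λ ()

  count-∖N-< : ∀ {S S′ v e u} → Stage S S′ v e → S′ u ≡ true → count (S′ ∖N[ u ]) < count S
  count-∖N-< {S} {S′} {u = u} st u∈S′ = begin-strict
    count (S′ ∖N[ u ])                            <⟨ m≤m+n _ _ ⟩
    suc (count (S′ ∖N[ u ])) + degree S′ u        ≡⟨ count-∖N S′ u u∈S′ ⟨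
    count S′                                      ≤⟨ count-mono (subset st) ⟩
    count S                                       ∎
    where open ≤-Reasoning

  -- The count is made in `S`, before any deletion: there `u` has degree at least that of `v` by
  -- minimality, and earlier deletions only shrink the branch.
  general-gap : ∀ {S S′ v e u} → Stage S S′ v (suc e) → S′ u ≡ true → adj v u ≡ true →
    count (S′ ∖N[ u ]) + suc (degree S v) ≤ count S
  general-gap {S} {S′} {v} {u = u} st u∈S′ vu = begin
    count (S′ ∖N[ u ]) + suc (degree S v)   ≤⟨ +-mono-≤ (count-mono sub) (s≤s (minimal st u (subset st u u∈S′))) ⟩
    count (S ∖N[ u ]) + suc (degree S u)    ≡⟨ +-suc _ _ ⟩
    suc (count (S ∖N[ u ])) + degree S u    ≡⟨ count-∖N S u (subset st u u∈S′) ⟨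
    count S                                 ∎
    where
    open ≤-Reasoning
    sub : ∀ i → (S′ ∖N[ u ]) i ≡ true → (S ∖N[ u ]) i ≡ true
    sub i p = let q , i≢u , r = ∖N⁻ S′ u i p in ∖N⁺ S u i (subset st i q) i≢u r

  -- Neighbours of v are pairwise nonadjacent, so u has lost no neighbour yet.
  triangle-free-gap : TriangleFree G → ∀ {S S′ v e u} → Stage S S′ v (suc e) → S′ u ≡ true → adj v u ≡ true →
    count (S′ ∖N[ u ]) + (degree S v + degree S v) ≤ count S + e
  triangle-free-gap tf {S} {S′} {v} {e} {u} st u∈S′ vu = s≤s⁻¹ (begin
    suc (count (S′ ∖N[ u ]) + (d + d))            ≡⟨ cong suc (+-assoc _ d d) ⟨
    suc (count (S′ ∖N[ u ])) + d + d              ≤⟨ +-monoˡ-≤ d (+-monoʳ-≤ (suc (count (S′ ∖N[ u ]))) d≤) ⟩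
    suc (count (S′ ∖N[ u ])) + degree S′ u + d    ≡⟨ cong (_+ d) (count-∖N S′ u u∈S′) ⟨
    count S′ + d                                  ≡⟨ size st ⟩
    count S + suc e                               ≡⟨ +-suc _ e ⟩
    suc (count S + e)                             ∎)
    where
    open ≤-Reasoning
    d = degree S v
    T⁺ : ∀ {b} → b ≡ true → T b
    T⁺ = Equivalence.from T-≡
    kept : ∀ i → S i ∧ adj u i ≡ true → S′ i ∧ adj u i ≡ true
    kept i p with S′ i in eq
    ... | true  = ∧-conicalʳ (S i) _ p
    ... | false = contradiction
      (T⁺ vu , T⁺ (∧-conicalʳ (S i) _ p) , T⁺ (deleted st i (∧-conicalˡ (S i) _ p) eq)) (tf v u i)
    d≤ : d ≤ degree S′ u
    d≤ = ≤-trans (minimal st u (subset st u u∈S′)) (count-mono kept)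

-- The branching induction and the two bounds

module BettiBounds {c ℓ : Level} (K : Field c ℓ) {n : ℕ} (G : Graph n) where
  open Graph G using (adj)
  open Neighbourhood G
  open Degree G
  open Complex K G
  open Comparison K G using (full; HomDim≤)
  open Homology K G using (TotalBetti; HomDim; sumℕ)

  -- Bounding all partial sums, not one of fixed length, makes the bound stable under `shift`.
  BettiSum≤ : VertexSet n → ℕ → Set _
  BettiSum≤ S b = ∃ λ g → (∀ k → HomologyDim≤ S k (g k)) × (∀ N → sumBelow g N ≤ b)

  deletion-link : ∀ {S v a l} → S v ≡ true → BettiSum≤ (S ∖ v) a → BettiSum≤ (S ∖N[ v ]) l →
    BettiSum≤ S (l + a)
  deletion-link {S} {v} {a} {l} v∈S (g , dg , g≤) (h , dh , h≤) =
    (λ k → g k + shift h k) , dims , λ N → begin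
      sumBelow (λ k → g k + shift h k) N     ≡⟨ sumBelow-+ g (shift h) N ⟩
      sumBelow g N + sumBelow (shift h) N    ≤⟨ +-mono-≤ (g≤ N) (shifted N) ⟩
      a + l                                  ≡⟨ +-comm a l ⟩
      l + a                                  ∎
    where
    open ≤-Reasoning
    dims : ∀ k → HomologyDim≤ S k (g k + shift h k)
    dims zero    = deletion-link-zero S v v∈S (dg 0)
    dims (suc k) = deletion-link-suc S v v∈S (dg (suc k)) (dh k)
    shifted : ∀ N → sumBelow (shift h) N ≤ l
    shifted zero    = z≤n
    shifted (suc N) = h≤ N

  BettiSum≤-isolated : ∀ {S v} → S v ≡ true → degree S v ≡ 0 → BettiSum≤ S 0
  BettiSum≤-isolated {S} {v} v∈S d≡0 =
    (λ _ → 0) , cone-acyclic v v∈S nonadj , λ N → ≤-reflexive (sumBelow-zero N)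
    where
    nonadj : ∀ i → S i ≡ true → adj v i ≡ false
    nonadj i p = subst (λ b → b ∧ adj v i ≡ false) p (count≡0⇒empty d≡0 i)

  BettiSum≤-empty : ∀ {S} → (∀ i → S i ≡ false) → BettiSum≤ S 1
  BettiSum≤-empty {S} empty = g , dims , bound
    where
    g : ℕ → ℕ
    g zero    = 1
    g (suc _) = 0
    dims : ∀ k → HomologyDim≤ S k (g k)
    dims zero    = empty-dim-zero S empty
    dims (suc k) = empty-dim-suc S empty k
    bound : ∀ N → sumBelow g N ≤ 1
    bound zero    = z≤n
    bound (suc N) = s≤s (≤-reflexive (sumBelow-zero N))

  module _ {Q : ℕ → ℕ → Set} {Gap : ℕ → ℕ → ℕ → ℕ → Set} (growth : Growth Q Gap)
    (gap : ∀ {S S′ v e u} → Stage S S′ v (suc e) → S′ u ≡ true → adj v u ≡ true →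
      Gap (count S) (degree S v) e (count (S′ ∖N[ u ])))
    where
    open Growth growth

    -- `m` bounds the number of vertices. Each link has fewer vertices than `S` and is handled with
    -- the smaller `m`; deleting a neighbour keeps `S`, `v` and `m` but lowers the number `e` of
    -- neighbours left.
    BettiSum≤-growth : ∀ m S → count S ≤ m → ∃ λ b → Q (count S) b × BettiSum≤ S b
    branching : ∀ m S → count S ≤ suc m → ∀ v e S′ → Stage S S′ v e →
      ∃ λ b → R (count S) (degree S v) e b × BettiSum≤ S′ b

    BettiSum≤-growth m S S≤m with any? (λ i → S i Bool.≟ true)
    ... | no none = 1 , subst (λ s → Q s 1) (sym (count-empty empty)) base , BettiSum≤-empty empty
      where
      empty : ∀ i → S i ≡ false
      empty i = ¬-not λ p → none (i , p)
    BettiSum≤-growth zero S S≤m | yes (v , v∈S) =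
      contradiction (≤-trans (≤-reflexive (sym (count-∖ S v v∈S))) S≤m) λ ()
    BettiSum≤-growth (suc m) S S≤m | yes (v₀ , v₀∈S) with min-degree-vertex S v₀ v₀∈S
    ... | v , v∈S , min with branching m S S≤m v (degree S v) S (initial v∈S min)
    ...   | b , r , bettis = b , R-finish _ _ _ r , bettis

    branching m S S≤m v zero S′ st =
      -- All neighbours are gone and `v` is a cone point, so the final deletion adds nothing and the
      -- sum has exactly one term per neighbour.
      0 , R-nil _ _ , BettiSum≤-isolated (Stage.centre st) (Stage.left st)
    branching m S S≤m v (suc e) S′ st with member (λ i → S′ i ∧ adj v i) (Stage.left st)
    ... | u , p with ∧-conicalˡ (S′ u) _ p | ∧-conicalʳ (S′ u) _ p
    ...   | u∈S′ | vu
      with BettiSum≤-growth m (S′ ∖N[ u ]) (s≤s⁻¹ (≤-trans (count-∖N-< st u∈S′) S≤m))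
         | branching m S S≤m v e (S′ ∖ u) (next st u∈S′ vu)
    ...     | b′ , q , link | b , r , deletion =
      b′ + b , R-cons _ _ _ _ _ _ (gap st u∈S′ vu) q r , deletion-link u∈S′ deletion link

    TotalBetti-growth : ∀ {b} → TotalBetti b → ∃ λ b′ → Q n b′ × b ≤ b′
    TotalBetti-growth (h , dims , refl) with BettiSum≤-growth (count full) full ≤-refl
    ... | b′ , q , g , dg , g≤ = b′ , subst (λ s → Q s b′) (count-full n) q ,
      ≤-trans (compare h g (λ k → HomDim≤ {k = toℕ k} (dg (toℕ k)) (dims k))) (g≤ (suc n))
      where
      compare : ∀ {m} (h : Fin m → ℕ) g → (∀ k → h k ≤ g (toℕ k)) → sumℕ h ≤ sumBelow g m
      compare {zero}  h g p = z≤n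
      compare {suc m} h g p = +-mono-≤ (p zero) (compare (h ∘ suc) (g ∘ suc) (p ∘ suc))

theorem1p1 : ∀ {c ℓ} (K : Field c ℓ) (n : ℕ) (G : Graph n) (b : ℕ) →
    TotalBettiInd K G b →
    (b ^ 5 ≤ 4 ^ n) ×
    (TriangleFree G →
    ∀ (p q : ℕ) → 0 < q →
    q ^ 6 + p * q ^ 5 + p ^ 2 * q ^ 4 < p ^ 6 →
    b * q ^ n ≤ p ^ n)
theorem1p1 K n G b betti = general , triangle-free
  where
  open Degree G
  open BettiBounds K G
  general : b ^ 5 ≤ 4 ^ n
  general with TotalBetti-growth general-growth general-gap betti
  ... | b′ , q , b≤b′ = ≤-trans (^-monoˡ-≤ 5 b≤b′) q
  triangle-free : TriangleFree G → ∀ (p q : ℕ) → 0 < q →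
    q ^ 6 + p * q ^ 5 + p ^ 2 * q ^ 4 < p ^ 6 → b * q ^ n ≤ p ^ n
  triangle-free tf p q 0<q h
    with TotalBetti-growth (TriangleFreeGrowth.triangle-free-growth p q 0<q h) (triangle-free-gap tf) betti
  ... | b′ , bound , b≤b′ = ≤-trans (*-monoˡ-≤ (q ^ n) b≤b′) bound
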